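{- Let $R=\{r_1,\ldots,r_l\}$ and $S=\{s_1,\ldots,s_m\}$ be disjoint sets of positive integers (with $r_1,\ldots,r_l$ distinct and $s_1,\ldots,s_m$ distinct), and let $I$ be a finite subset of $\mathbb{Z}^+\setminus(R\cup S)$. Suppose the greatest common divisor of $r_1,\ldots,r_l,s_1,\ldots,s_m$ is $1$. Then \[ \lim_{n\to\infty}\frac{p_{R>S,I}(n)}{p_{RSI}(n)}=\prod_{j=1}^l r_j\prod_{i=1}^m s_i\cdot\sum_{i=1}^l\frac{(-1)^{i-1}}{r_i\prod_{j=i+1}^l(r_j-r_i)\prod_{t=1}^{i-1}(r_i-r_t)\prod_{k=1}^m(s_k+r_i)}. \]
   Context: For pairwise disjoint sets $R,S,I\subseteq\mathbb{Z}^+$, $p_{RSI}(n)$ denotes the number of partitions of $n$ all of whose parts lie in $R\cup S\cup I$, and $p_{R>S,I}(n)$ denotes the number of those partitions in which the number of parts lying in $R$ (counted with multiplicity) is strictly greater than the number of parts lying in $S$ (counted with multiplicity). -}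

module Defs where

open import Data.Nat as ℕ using (ℕ; zero; suc; _<?_; _≟_)
open import Data.Nat.GCD using (gcd)
open import Data.Integer as ℤ using (ℤ; +_)
open import Data.Rational as ℚ using (ℚ; _/_; 0ℚ; 1ℚ; _+_; _*_; _-_; 1/_)
import Data.Rational.Properties as ℚP
open import Data.List as L using (List; []; _∷_; [_]; length; map; concatMap; upTo; filter; take; drop; zipWith; foldr; allFin; _++_)
open import Data.Vec as V using (Vec; lookup; toList)
open import Data.Fin using (Fin; toℕ)
open import Data.Nat.ListAction using (sum)
open import Relation.Nullary using (yes; no)
open import Relation.Nullary.Decidable using (¬?)

-- Partitions with parts from a list of DISTINCT part sizes `ps` are
-- encoded by multiplicity vectors c (c_k = number of copies of ps_k).

bounded : ℕ → ℕ → List (List ℕ)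
bounded zero    b = [ [] ]
bounded (suc k) b = concatMap (λ c → map (c ∷_) (bounded k b)) (upTo (suc b))

weight : List ℕ → List ℕ → ℕ
weight ps c = sum (zipWith ℕ._*_ ps c)

-- all partitions of n with parts in ps (positive parts, so every
-- multiplicity is ≤ n)
partitions : List ℕ → ℕ → List (List ℕ)
partitions ps n = filter (λ c → weight ps c ≟ n) (bounded (length ps) n)

parts : ∀ {l m} → Vec ℕ l → Vec ℕ m → List ℕ → List ℕ
parts R S I = toList R ++ toList S ++ I

pRSI : ∀ {l m} → Vec ℕ l → Vec ℕ m → List ℕ → ℕ → ℕ
pRSI R S I n = length (partitions (parts R S I) n)

partsInR : ∀ {l m} → Vec ℕ l → Vec ℕ m → List ℕ → ℕ
partsInR {l} R S c = sum (take l c)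

partsInS : ∀ {l m} → Vec ℕ l → Vec ℕ m → List ℕ → ℕ
partsInS {l} {m} R S c = sum (take m (drop l c))

pR>S : ∀ {l m} → Vec ℕ l → Vec ℕ m → List ℕ → ℕ → ℕ
pR>S R S I n =
  length (filter (λ c → partsInS R S c <? partsInR R S c) (partitions (parts R S I) n))

toℚ : ℕ → ℚ
toℚ n = + n / 1

-- total inverse (convention 0⁻¹ = 0; only ever applied to nonzero values
-- under the theorem's hypotheses)
inv : ℚ → ℚ
inv q with q ℚP.≟ 0ℚ
... | yes _ = 0ℚ
... | no q≢0 = 1/_ q {{ℚ.≢-nonZero q≢0}}

prodℚ : List ℚ → ℚ
prodℚ = foldr _*_ 1ℚ

sumℚ : List ℚ → ℚ
sumℚ = foldr _+_ 0ℚ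

-- the limit value
--   ∏ r_j ∏ s_i · Σ_{i=1}^l (-1)^{i-1} /
--      ( r_i ∏_{j>i}(r_j - r_i) ∏_{t<i}(r_i - r_t) ∏_k (s_k + r_i) )
-- (Fin indices are 0-based: index i here is the paper's i+1.)
sign : ℕ → ℚ
sign zero    = 1ℚ
sign (suc k) = ℚ.- sign k

limitValue : ∀ {l m} → Vec ℕ l → Vec ℕ m → ℚ
limitValue {l} {m} R S =
  prodℚ (map toℚ (toList R)) * prodℚ (map toℚ (toList S)) *
  sumℚ (map term (allFin l))
  where
  r : Fin l → ℚ
  r i = toℚ (lookup R i)
  term : Fin l → ℚ
  term i = sign (toℕ i) * inv
    ( r i
    * prodℚ (map (λ j → r j - r i) (filter (λ j → toℕ i <? toℕ j) (allFin l)))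
    * prodℚ (map (λ t → r i - r t) (filter (λ t → toℕ t <? toℕ i) (allFin l)))
    * prodℚ (map (λ k → toℚ (lookup S k) + r i) (allFin m)))

gcdAll : List ℕ → ℕ
gcdAll = foldr gcd 0

{-# OPTIONS --safe #-}
module Submission where

-- A common copy of r ∈ R and s ∈ S can be replaced by one balanced part r + s.  At the level of generating
-- functions, with X = x^r z and Y = x^s z^-1, this is
--   1/((1-X)(1-Y)) = (1/(1-X) + 1/(1-Y) - 1) / (1-XY),
-- and it removes r or s until R or S is empty, while keeping the number of parts and their gcd.  The term "-1"
-- has one part fewer and is negligible.  If R = ∅ nothing is counted; if S = ∅ asymptotically everything is.
-- Each resulting count is asymptotic to C(n+k, k) / ∏ parts, where k + 1 is the number of parts: by Bézout the
-- count p is almost invariant under n ↦ n + 1, hence a·p is close to a sum of p over a consecutive values, which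
-- is the count with the part a replaced by 1.
-- The stated limit satisfies the same recursion since, as a function of R, it is a divided difference of
-- x ↦ 1 / (x ∏ (s + x)).

open import Defs
open import Data.Bool using (true; false; if_then_else_)
open import Data.Empty using (⊥-elim)
open import Data.Fin as Fin using (Fin; toℕ)
open import Data.Integer as ℤ using (ℤ; +_; -[1+_])
import Data.Integer.Properties as ℤP
open import Data.List using (List; []; _∷_; _++_; [_]; foldr; map; length; replicate; allFin; filter; tabulate; take; drop; upTo; concatMap)
open import Data.List.Membership.Propositional using (_∈_; _∉_)
open import Data.List.Membership.Propositional.Properties using (∈-∃++)
open import Data.List.Properties using (length-++; length-replicate; length-map; map-++; ++-identityʳ; map-tabulate; tabulate-cong; map-cong; map-∘; map-applyUpTo)
open import Data.List.Relation.Binary.Permutation.Propositional as Perm using (_↭_)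
open import Data.List.Relation.Binary.Permutation.Propositional.Properties as PermP using (All-resp-↭)
open import Data.List.Relation.Unary.All as All using (All; []; _∷_)
import Data.List.Relation.Unary.All.Properties as AllP
open import Data.List.Relation.Unary.AllPairs using ([]; _∷_)
open import Data.List.Relation.Unary.Unique.Propositional using (Unique)
import Data.List.Relation.Unary.Unique.Propositional.Properties as UniqueP
open import Data.Maybe using (Maybe; just; nothing)
open import Data.Nat as ℕ using (ℕ; zero; suc; _≤_; _<_; z≤n; s≤s; NonZero; _!)
open import Data.Nat.Divisibility using (_∣_; _∣0; ∣-trans; ∣1⇒≡1; ∣m+n∣m⇒∣n)
open import Data.Nat.GCD using (gcd; gcd[m,n]∣m; gcd[m,n]∣n; gcd-greatest; gcd-GCD; module Bézout)
open import Data.Nat.ListAction using (sum)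
import Data.Nat.Properties as ℕP
open import Data.Product using (Σ; ∃; _×_; _,_; proj₁; proj₂)
open import Data.Rational as Q using (ℚ; _/_; _+_; _*_; _-_; -_; ∣_∣; 0ℚ; 1ℚ)
import Data.Rational.Properties as ℚP
import Data.Rational.Unnormalised as ℚᵘ
import Data.Rational.Unnormalised.Properties as ℚᵘP
open import Data.Sum using (inj₁; inj₂)
open import Data.Vec using (Vec; lookup; toList)
open import Function using (_∘_; id)
open import Relation.Binary using (tri<; tri≈; tri>)
open import Relation.Binary.PropositionalEquality hiding ([_])
open import Relation.Nullary using (¬_; yes; no; Dec; does)
open import Relation.Unary using (Decidable)
open import Tactic.RingSolver using (solve-∀)
open import Tactic.RingSolver.Core.AlmostCommutativeRing using (AlmostCommutativeRing; fromCommutativeRing)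

-- Rational arithmetic

-- Laurent series in z are avoided: a family `f d n` carries a starting balance `d`, multiplication
-- by x^a z^t shifts `n` by `a` and evaluates at `d + t`, and the condition on the final balance
-- sits in the seed alone. Operator identities thus hold for every seed, and `δ` and `δ⁺` share
-- them. Lists stand for multisets of coloured parts, because r + s may equal a part that is already
-- present. A count with k + 1 coprime parts has order n^k, so errors are measured against n^(k-1).
-- This is the size of any count with one part fewer, and such counts are what the term "-1" and the
-- difference p(n + a) - p(n) consist of. Coprimality is carried for all parts together, since r + s
-- joins the neutral ones; it survives because a common divisor of r and r + s divides s. As the
-- number of parts is constant, all branches of the recursion are compared with one function, the
-- count with k + 1 parts equal to 1, whose size enters through a lower bound of order n^k.

ℚ-ring : AlmostCommutativeRing _ _
ℚ-ring = fromCommutativeRing ℚP.+-*-commutativeRing isZero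
  where
  isZero : ∀ x → Maybe (0ℚ ≡ x)
  isZero x with 0ℚ ℚP.≟ x
  ... | yes p = just p
  ... | no _  = nothing

-- `_/_` normalises by a gcd and does not reduce on variables; over unnormalised rationals the
-- identities become integer equations.
toℚᵘ-toℚ : ∀ n → Q.toℚᵘ (toℚ n) ℚᵘ.≃ ℚᵘ.mkℚᵘ (+ n) 0
toℚᵘ-toℚ n = ℚP.toℚᵘ-fromℚᵘ (ℚᵘ.mkℚᵘ (+ n) 0)

toℚ-+ : ∀ m n → toℚ (m ℕ.+ n) ≡ toℚ m + toℚ n
toℚ-+ m n = ℚP.toℚᵘ-injective (begin
  Q.toℚᵘ (toℚ (m ℕ.+ n))                      ≈⟨ toℚᵘ-toℚ (m ℕ.+ n) ⟩
  ℚᵘ.mkℚᵘ (+ (m ℕ.+ n)) 0                     ≈⟨ ℚᵘ.*≡* (cong (ℤ._* + 1) (sym (cong₂ ℤ._+_ (ℤP.*-identityʳ (+ m)) (ℤP.*-identityʳ (+ n))))) ⟩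
  ℚᵘ.mkℚᵘ (+ m) 0 ℚᵘ.+ ℚᵘ.mkℚᵘ (+ n) 0        ≈⟨ ℚᵘP.+-cong (ℚᵘP.≃-sym (toℚᵘ-toℚ m)) (ℚᵘP.≃-sym (toℚᵘ-toℚ n)) ⟩
  Q.toℚᵘ (toℚ m) ℚᵘ.+ Q.toℚᵘ (toℚ n)          ≈⟨ ℚP.toℚᵘ-homo-+ (toℚ m) (toℚ n) ⟨
  Q.toℚᵘ (toℚ m + toℚ n)                      ∎)
  where open ℚᵘP.≃-Reasoning

toℚ-suc : ∀ n → toℚ (suc n) ≡ 1ℚ + toℚ n
toℚ-suc n = toℚ-+ 1 n

toℚ-* : ∀ m n → toℚ (m ℕ.* n) ≡ toℚ m * toℚ n
toℚ-* zero n = sym (ℚP.*-zeroˡ (toℚ n))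
toℚ-* (suc m) n = begin
  toℚ (n ℕ.+ m ℕ.* n)       ≡⟨ toℚ-+ n (m ℕ.* n) ⟩
  toℚ n + toℚ (m ℕ.* n)     ≡⟨ cong (_+_ (toℚ n)) (toℚ-* m n) ⟩
  toℚ n + toℚ m * toℚ n     ≡⟨ lem (toℚ n) (toℚ m) ⟩
  (1ℚ + toℚ m) * toℚ n      ≡⟨ cong (_* toℚ n) (sym (toℚ-suc m)) ⟩
  toℚ (suc m) * toℚ n       ∎
  where
  open ≡-Reasoning
  lem : ∀ x y → x + y * x ≡ (1ℚ + y) * x
  lem = solve-∀ ℚ-ring

0≤toℚ : ∀ n → 0ℚ Q.≤ toℚ n
0≤toℚ n = ℚP.nonNegative⁻¹ (toℚ n) {{ℚP.normalize-nonNeg n 1}}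

p≤p+q : ∀ p {q} → 0ℚ Q.≤ q → p Q.≤ p + q
p≤p+q p {q} 0≤q = subst (Q._≤ p + q) (ℚP.+-identityʳ p) (ℚP.+-monoʳ-≤ p 0≤q)

0≤p*q : ∀ {p q} → 0ℚ Q.≤ p → 0ℚ Q.≤ q → 0ℚ Q.≤ p * q
0≤p*q {p} {q} 0≤p 0≤q =
  ℚP.nonNegative⁻¹ (p * q) {{ℚP.nonNeg*nonNeg⇒nonNeg p {{Q.nonNegative 0≤p}} q {{Q.nonNegative 0≤q}}}}

0<p*q : ∀ {p q} → 0ℚ Q.< p → 0ℚ Q.< q → 0ℚ Q.< p * q
0<p*q {p} {q} 0<p 0<q =
  ℚP.positive⁻¹ (p * q) {{ℚP.pos*pos⇒pos p {{Q.positive 0<p}} q {{Q.positive 0<q}}}}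

*-monoˡ : ∀ {p} → 0ℚ Q.≤ p → ∀ {x y} → x Q.≤ y → p * x Q.≤ p * y
*-monoˡ {p} 0≤p = ℚP.*-monoˡ-≤-nonNeg p {{Q.nonNegative 0≤p}}

*-monoʳ : ∀ {p} → 0ℚ Q.≤ p → ∀ {x y} → x Q.≤ y → x * p Q.≤ y * p
*-monoʳ {p} 0≤p = ℚP.*-monoʳ-≤-nonNeg p {{Q.nonNegative 0≤p}}

toℚ-mono-≤ : ∀ {m n} → m ≤ n → toℚ m Q.≤ toℚ n
toℚ-mono-≤ {m} m≤n with ℕP.m≤n⇒∃[o]m+o≡n m≤n
... | o , refl = subst (toℚ m Q.≤_) (sym (toℚ-+ m o)) (p≤p+q (toℚ m) (0≤toℚ o))

0<toℚ : ∀ {n} → 0 < n → 0ℚ Q.< toℚ n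
0<toℚ 0<n = ℚP.<-≤-trans (ℚP.positive⁻¹ 1ℚ) (toℚ-mono-≤ 0<n)

0<⇒≢0 : ∀ {p} → 0ℚ Q.< p → p ≢ 0ℚ
0<⇒≢0 0<p refl = ℚP.<-irrefl refl 0<p

toℚ-mono-< : ∀ {m n} → m < n → toℚ m Q.< toℚ n
toℚ-mono-< {m} {n} m<n = ℚP.<-≤-trans
  (subst₂ Q._<_ (ℚP.+-identityˡ (toℚ m)) (sym (toℚ-suc m)) (ℚP.+-monoˡ-< (toℚ m) (ℚP.positive⁻¹ 1ℚ)))
  (toℚ-mono-≤ m<n)

toℚ-injective : ∀ {m n} → toℚ m ≡ toℚ n → m ≡ n
toℚ-injective {m} {n} eq with ℕP.<-cmp m n
... | tri< m<n _ _ = ⊥-elim (ℚP.<⇒≢ (toℚ-mono-< m<n) eq)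
... | tri≈ _ m≡n _ = m≡n
... | tri> _ _ n<m = ⊥-elim (ℚP.<⇒≢ (toℚ-mono-< n<m) (sym eq))

inv-inverseʳ : ∀ {q} → q ≢ 0ℚ → q * inv q ≡ 1ℚ
inv-inverseʳ {q} q≢0 with q ℚP.≟ 0ℚ
... | yes q≡0 = ⊥-elim (q≢0 q≡0)
... | no q≢0′ = ℚP.*-inverseʳ q {{Q.≢-nonZero q≢0′}}

*≡1⇒≢0 : ∀ x y → x * y ≡ 1ℚ → x ≢ 0ℚ
*≡1⇒≢0 x y eq refl with trans (sym (ℚP.*-zeroˡ y)) eq
... | ()

inv-unique : ∀ x y → x * y ≡ 1ℚ → inv x ≡ y
inv-unique x y xy≡1 = begin
  inv x            ≡⟨ ℚP.*-identityʳ (inv x) ⟨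
  inv x * 1ℚ       ≡⟨ cong (inv x *_) xy≡1 ⟨
  inv x * (x * y)  ≡⟨ lem (inv x) x y ⟩
  (x * inv x) * y  ≡⟨ cong (_* y) (inv-inverseʳ (*≡1⇒≢0 x y xy≡1)) ⟩
  1ℚ * y           ≡⟨ ℚP.*-identityˡ y ⟩
  y                ∎
  where
  open ≡-Reasoning
  lem : ∀ i x y → i * (x * y) ≡ (x * i) * y
  lem = solve-∀ ℚ-ring

-- The convention that `inv 0ℚ` is `0ℚ` removes every side condition, so a product of denominators
-- can be split before anything is known about its factors.
inv-* : ∀ x y → inv (x * y) ≡ inv x * inv y
inv-* x y = by-cases (x ℚP.≟ 0ℚ) (y ℚP.≟ 0ℚ)
  where
  open ≡-Reasoning
  lem : ∀ x y a b → x * y * (a * b) ≡ (x * a) * (y * b)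
  lem = solve-∀ ℚ-ring
  by-cases : Dec (x ≡ 0ℚ) → Dec (y ≡ 0ℚ) → inv (x * y) ≡ inv x * inv y
  by-cases (yes refl) _ = trans (cong inv (ℚP.*-zeroˡ y)) (sym (ℚP.*-zeroˡ (inv y)))
  by-cases (no _) (yes refl) = trans (cong inv (ℚP.*-zeroʳ x)) (sym (ℚP.*-zeroʳ (inv x)))
  by-cases (no x≢0) (no y≢0) = inv-unique (x * y) (inv x * inv y) (begin
    x * y * (inv x * inv y)     ≡⟨ lem x y (inv x) (inv y) ⟩
    (x * inv x) * (y * inv y)   ≡⟨ cong₂ _*_ (inv-inverseʳ x≢0) (inv-inverseʳ y≢0) ⟩
    1ℚ                          ∎)

inv-neg : ∀ x → inv (- x) ≡ - inv x
inv-neg x = begin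
  inv (- x)            ≡⟨ cong inv (trans (sym (ℚP.neg-distribˡ-* 1ℚ x)) (cong -_ (ℚP.*-identityˡ x))) ⟨
  inv (- 1ℚ * x)       ≡⟨ inv-* (- 1ℚ) x ⟩
  - 1ℚ * inv x         ≡⟨ lem (inv x) ⟩
  - inv x              ∎
  where
  open ≡-Reasoning
  lem : ∀ x → - 1ℚ * x ≡ - x
  lem = solve-∀ ℚ-ring

-- Generating functions

-- Multiplication of a power series by x^a, on coefficients.
shift : ℕ → (ℕ → ℚ) → ℕ → ℚ
shift zero    f n       = f n
shift (suc a) f zero    = 0ℚ
shift (suc a) f (suc n) = shift a f n

shift-+ : ∀ a b f n → shift a (shift b f) n ≡ shift (a ℕ.+ b) f n
shift-+ zero    b f n       = refl
shift-+ (suc a) b f zero    = refl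
shift-+ (suc a) b f (suc n) = shift-+ a b f n

shift-at : ∀ a f n → shift a f (a ℕ.+ n) ≡ f n
shift-at zero    f n = refl
shift-at (suc a) f n = shift-at a f n

shift-below : ∀ {a n} f → n < a → shift a f n ≡ 0ℚ
shift-below {suc a} {zero}  f _         = refl
shift-below {suc a} {suc n} f (s≤s n<a) = shift-below f n<a

shift-cong : ∀ a {f g} n → (∀ m → f m ≡ g m) → shift a f n ≡ shift a g n
shift-cong zero    n       f≗g = f≗g n
shift-cong (suc a) zero    f≗g = refl
shift-cong (suc a) (suc n) f≗g = shift-cong a n f≗g

shift-cong-≤ : ∀ a {f g} n → (∀ m → m ≤ n → f m ≡ g m) → shift a f n ≡ shift a g n
shift-cong-≤ zero    n       f≗g = f≗g n ℕP.≤-refl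
shift-cong-≤ (suc a) zero    f≗g = refl
shift-cong-≤ (suc a) (suc n) f≗g = shift-cong-≤ a n λ m m≤n → f≗g m (ℕP.m≤n⇒m≤1+n m≤n)

-- A positive shift looks at smaller indices only. This drives the inductions on `n` for `T`.
shift-cong-< : ∀ {a} → 0 < a → ∀ {f g} n → (∀ m → m < n → f m ≡ g m) → shift a f n ≡ shift a g n
shift-cong-< {suc a} _ zero    f≗g = refl
shift-cong-< {suc a} _ (suc n) f≗g = shift-cong-≤ a n λ m m≤n → f≗g m (s≤s m≤n)

shift-mono : ∀ a {f g} n → (∀ m → f m Q.≤ g m) → shift a f n Q.≤ shift a g n
shift-mono zero    n       f≤g = f≤g n
shift-mono (suc a) zero    f≤g = ℚP.≤-refl
shift-mono (suc a) (suc n) f≤g = shift-mono a n f≤g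

shift-0 : ∀ a n → shift a (λ _ → 0ℚ) n ≡ 0ℚ
shift-0 zero    n       = refl
shift-0 (suc a) zero    = refl
shift-0 (suc a) (suc n) = shift-0 a n

shift-add : ∀ a f g n → shift a (λ m → f m + g m) n ≡ shift a f n + shift a g n
shift-add zero    f g n       = refl
shift-add (suc a) f g zero    = refl
shift-add (suc a) f g (suc n) = shift-add a f g n

shift-sub : ∀ a f g n → shift a (λ m → f m - g m) n ≡ shift a f n - shift a g n
shift-sub zero    f g n       = refl
shift-sub (suc a) f g zero    = refl
shift-sub (suc a) f g (suc n) = shift-sub a f g n

-- A part (a , t): every copy adds a to the size n and t to the balance d.
Part : Set
Part = ℕ × ℤ

Pos : Part → Set
Pos (a , _) = 0 < a

-- In `f d n`, `d` is the balance accumulated so far and `n` the size still to be filled.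
Family : Set
Family = ℤ → ℕ → ℚ

infix 4 _≋_
_≋_ : Family → Family → Set
f ≋ g = ∀ d n → f d n ≡ g d n

_⊕_ _⊖_ : Family → Family → Family
(f ⊕ g) d n = f d n + g d n
(f ⊖ g) d n = f d n - g d n

infix 8 _⊙_
_⊙_ : Part → Part → Part
(a , t) ⊙ (b , u) = a ℕ.+ b , t ℤ.+ u

X : Part → Family → Family
X (a , t) h d = shift a (h (d ℤ.+ t))

X-cong : ∀ x {f g} → f ≋ g → X x f ≋ X x g
X-cong (a , t) f≋g d n = shift-cong a n (f≋g (d ℤ.+ t))

X-⊙ : ∀ x y f → X x (X y f) ≋ X (x ⊙ y) f
X-⊙ (a , t) (b , u) f d n =
  trans (shift-+ a b (f (d ℤ.+ t ℤ.+ u)) n) (cong (λ e → shift (a ℕ.+ b) (f e) n) (ℤP.+-assoc d t u))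

X-comm : ∀ x y f → X x (X y f) ≋ X y (X x f)
X-comm x@(a , t) y@(b , u) f d n = begin
  X x (X y f) d n   ≡⟨ X-⊙ x y f d n ⟩
  X (x ⊙ y) f d n   ≡⟨ cong₂ (λ c v → X (c , v) f d n) (ℕP.+-comm a b) (ℤP.+-comm t u) ⟩
  X (y ⊙ x) f d n   ≡⟨ X-⊙ y x f d n ⟨
  X y (X x f) d n   ∎
  where open ≡-Reasoning

-- Horner form of the partial sum g + Xg + ... + X^b g.
iterate : ℕ → Part → Family → Family
iterate zero    x g d n = g d n
iterate (suc b) x g d n = g d n + X x (iterate b x g) d n

-- T x = 1 / (1 - X x): the term X xʲ vanishes at n once j > n, so n steps of the geometric series suffice.
T : Part → Family → Family
T x g d n = iterate n x g d n

iterate-stable : ∀ {x} → Pos x → ∀ g b c d n → n ≤ b → n ≤ c → iterate b x g d n ≡ iterate c x g d n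
iterate-stable {x} px g zero    zero    d n    n≤b n≤c = refl
iterate-stable {suc a , t} px g zero    (suc c) d zero n≤b n≤c = sym (ℚP.+-identityʳ (g d 0))
iterate-stable {suc a , t} px g (suc b) zero    d zero n≤b n≤c = ℚP.+-identityʳ (g d 0)
iterate-stable {a , t} px g (suc b) (suc c) d n    n≤b n≤c = cong (_+_ (g d n))
  (shift-cong-< px n λ m m<n → iterate-stable px g b c (d ℤ.+ t) m
    (ℕP.≤-pred (ℕP.<-≤-trans m<n n≤b)) (ℕP.≤-pred (ℕP.<-≤-trans m<n n≤c)))

T-step : ∀ {x} → Pos x → ∀ g → T x g ≋ g ⊕ X x (T x g)
T-step {suc a , t} px g d zero = sym (ℚP.+-identityʳ (g d 0))
T-step {a , t} px g d (suc n) = cong (_+_ (g d (suc n)))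
  (shift-cong-< px (suc n) λ m m<n → iterate-stable px g n m (d ℤ.+ t) m (ℕP.≤-pred m<n) ℕP.≤-refl)

-- The equation determines `h` at `n` from its values below `n`. Identities for `T` are proved by
-- checking this equation instead of rearranging sums.
T-unique : ∀ {x} → Pos x → ∀ {g h} → h ≋ g ⊕ X x h → h ≋ T x g
T-unique {x@(a , t)} px {g} {h} eq d n = go (suc n) d n ℕP.≤-refl
  where
  go : ∀ N d n → n < N → h d n ≡ T x g d n
  go (suc N) d n (s≤s n≤N) = begin
    h d n                  ≡⟨ eq d n ⟩
    g d n + X x h d n      ≡⟨ cong (_+_ (g d n)) (shift-cong-< px n λ m m<n → go N (d ℤ.+ t) m (ℕP.<-≤-trans m<n n≤N)) ⟩
    g d n + X x (T x g) d n ≡⟨ T-step px g d n ⟨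
    T x g d n              ∎
    where open ≡-Reasoning

iterate-cong : ∀ b x {f g} → f ≋ g → iterate b x f ≋ iterate b x g
iterate-cong zero    x f≋g d n = f≋g d n
iterate-cong (suc b) x f≋g d n = cong₂ _+_ (f≋g d n) (X-cong x (iterate-cong b x f≋g) d n)

T-cong : ∀ x {f g} → f ≋ g → T x f ≋ T x g
T-cong x f≋g d n = iterate-cong n x f≋g d n

T-add : ∀ {x} → Pos x → ∀ f g → T x f ⊕ T x g ≋ T x (f ⊕ g)
T-add {x@(a , t)} px f g = T-unique px λ d n → begin
  T x f d n + T x g d n
    ≡⟨ cong₂ _+_ (T-step px f d n) (T-step px g d n) ⟩
  (f d n + X x (T x f) d n) + (g d n + X x (T x g) d n)
    ≡⟨ lem (f d n) (X x (T x f) d n) (g d n) (X x (T x g) d n) ⟩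
  (f d n + g d n) + (X x (T x f) d n + X x (T x g) d n)
    ≡⟨ cong (_+_ (f d n + g d n)) (shift-add a (T x f (d ℤ.+ t)) (T x g (d ℤ.+ t)) n) ⟨
  (f d n + g d n) + X x (T x f ⊕ T x g) d n ∎
  where
  open ≡-Reasoning
  lem : ∀ a b c d → (a + b) + (c + d) ≡ (a + c) + (b + d)
  lem = solve-∀ ℚ-ring

T-sub : ∀ {x} → Pos x → ∀ f g → T x f ⊖ T x g ≋ T x (f ⊖ g)
T-sub {x@(a , t)} px f g = T-unique px λ d n → begin
  T x f d n - T x g d n
    ≡⟨ cong₂ _-_ (T-step px f d n) (T-step px g d n) ⟩
  (f d n + X x (T x f) d n) - (g d n + X x (T x g) d n)
    ≡⟨ lem (f d n) (X x (T x f) d n) (g d n) (X x (T x g) d n) ⟩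
  (f d n - g d n) + (X x (T x f) d n - X x (T x g) d n)
    ≡⟨ cong (_+_ (f d n - g d n)) (shift-sub a (T x f (d ℤ.+ t)) (T x g (d ℤ.+ t)) n) ⟨
  (f d n - g d n) + X x (T x f ⊖ T x g) d n ∎
  where
  open ≡-Reasoning
  lem : ∀ a b c d → (a + b) - (c + d) ≡ (a - c) + (b - d)
  lem = solve-∀ ℚ-ring

X-T : ∀ x {y} → Pos y → ∀ g → X x (T y g) ≋ T y (X x g)
X-T x@(a , t) {y} py g = T-unique py λ d n → begin
  X x (T y g) d n                       ≡⟨ X-cong x (T-step py g) d n ⟩
  X x (g ⊕ X y (T y g)) d n             ≡⟨ shift-add a (g (d ℤ.+ t)) (X y (T y g) (d ℤ.+ t)) n ⟩
  X x g d n + X x (X y (T y g)) d n     ≡⟨ cong (_+_ (X x g d n)) (X-comm x y (T y g) d n) ⟩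
  X x g d n + X y (X x (T y g)) d n     ∎
  where open ≡-Reasoning

T-comm : ∀ {x y} → Pos x → Pos y → ∀ g → T y (T x g) ≋ T x (T y g)
T-comm {x} {y} px py g = T-unique px λ d n → begin
  T y (T x g) d n                        ≡⟨ T-cong y (T-step px g) d n ⟩
  T y (g ⊕ X x (T x g)) d n              ≡⟨ T-add py g (X x (T x g)) d n ⟨
  T y g d n + T y (X x (T x g)) d n      ≡⟨ cong (_+_ (T y g d n)) (X-T x py (T x g) d n) ⟨
  T y g d n + X x (T y (T x g)) d n      ∎
  where open ≡-Reasoning

-- 1 - XY = (1 - X) + (1 - Y) - (1 - X)(1 - Y), divided by (1 - X)(1 - Y)(1 - XY).
T-pair : ∀ {x y} → Pos x → Pos y → ∀ g →
  T x (T y g) ≋ T (x ⊙ y) (T x g) ⊕ (T (x ⊙ y) (T y g) ⊖ T (x ⊙ y) g)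
T-pair {x@(a , t)} {y@(b , u)} px py g d n = begin
  h d n                                        ≡⟨ T-unique pz h-eq d n ⟩
  T z (T x g ⊕ (T y g ⊖ g)) d n                ≡⟨ T-add pz (T x g) (T y g ⊖ g) d n ⟨
  T z (T x g) d n + T z (T y g ⊖ g) d n        ≡⟨ cong (_+_ (T z (T x g) d n)) (T-sub pz (T y g) g d n) ⟨
  T z (T x g) d n + (T z (T y g) d n - T z g d n) ∎
  where
  open ≡-Reasoning
  z = x ⊙ y
  pz : Pos z
  pz = ℕP.<-≤-trans px (ℕP.m≤m+n a b)
  h = T x (T y g)
  h-eq : h ≋ (T x g ⊕ (T y g ⊖ g)) ⊕ X z h
  h-eq d n = begin
    h d n
      ≡⟨ T-step px (T y g) d n ⟩
    T y g d n + X x h d n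
      -- `T y` is brought to the outside before it is unfolded, so that its step puts `X y` next to
      -- `X x` and XY appears.
      ≡⟨ cong (_+_ (T y g d n)) (X-cong x (λ e m → trans (T-comm py px g e m) (T-step py (T x g) e m)) d n) ⟩
    T y g d n + X x (T x g ⊕ X y h′) d n
      ≡⟨ cong (_+_ (T y g d n)) (shift-add a (T x g (d ℤ.+ t)) (X y h′ (d ℤ.+ t)) n) ⟩
    T y g d n + (X x (T x g) d n + X x (X y h′) d n)
      ≡⟨ cong (λ w → T y g d n + (X x (T x g) d n + w)) (trans (X-⊙ x y h′ d n) (X-cong z (T-comm px py g) d n)) ⟩
    T y g d n + (X x (T x g) d n + X z h d n)
      ≡⟨ lem₂ (T y g d n) (X x (T x g) d n) (X z h d n) (g d n) ⟩
    ((g d n + X x (T x g) d n) + (T y g d n - g d n)) + X z h d n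
      ≡⟨ cong (λ w → (w + (T y g d n - g d n)) + X z h d n) (T-step px g d n) ⟨
    (T x g d n + (T y g d n - g d n)) + X z h d n ∎
    where
    h′ = T y (T x g)
    lem₂ : ∀ p r q g → p + (r + q) ≡ ((g + r) + (p - g)) + q
    lem₂ = solve-∀ ℚ-ring

iterate-mono : ∀ b x {f g} → (∀ d n → f d n Q.≤ g d n) → ∀ d n → iterate b x f d n Q.≤ iterate b x g d n
iterate-mono zero    x f≤g d n = f≤g d n
iterate-mono (suc b) x@(a , t) f≤g d n =
  ℚP.+-mono-≤ (f≤g d n) (shift-mono a n (iterate-mono b x f≤g (d ℤ.+ t)))

F : Family → List Part → Family
F g = foldr T g

F-cong : ∀ {f g} → f ≋ g → ∀ xs → F f xs ≋ F g xs
F-cong f≋g []       = f≋g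
F-cong f≋g (x ∷ xs) = T-cong x (F-cong f≋g xs)

F-mono : ∀ {f g} → (∀ d n → f d n Q.≤ g d n) → ∀ xs d n → F f xs d n Q.≤ F g xs d n
F-mono f≤g []       d n = f≤g d n
F-mono f≤g (x ∷ xs) d n = iterate-mono n x (F-mono f≤g xs) d n

F-↭ : ∀ g {xs ys} → All Pos xs → xs ↭ ys → F g xs ≋ F g ys
F-↭ g pxs            Perm.refl         d n = refl
F-↭ g (px ∷ pxs)     (Perm.prep x p)   = T-cong x (F-↭ g pxs p)
F-↭ g {_ ∷ _ ∷ xs} (px ∷ py ∷ pxs) (Perm.swap x y p) d n =
  trans (T-comm py px (F g xs) d n) (T-cong y (T-cong x (F-↭ g pxs p)) d n)
F-↭ g pxs            (Perm.trans p q)  d n =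
  trans (F-↭ g pxs p d n) (F-↭ g (All-resp-↭ p pxs) q d n)

-- Counting and error terms

δ : Family
δ _ zero    = 1ℚ
δ _ (suc _) = 0ℚ

neutral : ℕ → Part
neutral a = a , + 0

-- Coefficients of the product of the series 1/(1 - x^a); equal entries act as parts of different
-- colours.
count : List ℕ → ℕ → ℚ
count as = F δ (map neutral as) (+ 0)

Positive : List ℕ → Set
Positive = All (0 <_)

neutral-Pos : ∀ {as} → Positive as → All Pos (map neutral as)
neutral-Pos []         = []
neutral-Pos (pa ∷ pas) = pa ∷ neutral-Pos pas

count-step : ∀ {a} → 0 < a → ∀ as n → count (a ∷ as) n ≡ count as n + shift a (count (a ∷ as)) n
count-step pa as n = T-step pa (F δ (map neutral as)) (+ 0) n

count-below : ∀ {a} → 0 < a → ∀ as {n} → n < a → count (a ∷ as) n ≡ count as n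
count-below {a} pa as {n} n<a = begin
  count (a ∷ as) n                            ≡⟨ count-step pa as n ⟩
  count as n + shift a (count (a ∷ as)) n     ≡⟨ cong (_+_ (count as n)) (shift-below (count (a ∷ as)) n<a) ⟩
  count as n + 0ℚ                             ≡⟨ ℚP.+-identityʳ (count as n) ⟩
  count as n                                  ∎
  where open ≡-Reasoning

count-above : ∀ {a} → 0 < a → ∀ as n → count (a ∷ as) (a ℕ.+ n) ≡ count as (a ℕ.+ n) + count (a ∷ as) n
count-above {a} pa as n =
  trans (count-step pa as (a ℕ.+ n)) (cong (_+_ (count as (a ℕ.+ n))) (shift-at a (count (a ∷ as)) n))

count-↭ : ∀ {as bs} → Positive as → as ↭ bs → ∀ n → count as n ≡ count bs n
count-↭ pas p = F-↭ δ (neutral-Pos pas) (PermP.map⁺ neutral p) (+ 0)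

-- `δ` ignores the balance, so the tags of the parts can be forgotten.
F-δ : ∀ {xs} → All Pos xs → ∀ d n → F δ xs d n ≡ count (map proj₁ xs) n
F-δ []                     d zero    = refl
F-δ []                     d (suc n) = refl
F-δ {x@(a , t) ∷ xs} (px ∷ pxs) d n = begin
  T x (F δ xs) d n             ≡⟨ T-cong x (F-δ pxs) d n ⟩
  T x (λ _ → count as) d n     ≡⟨ T-unique px {h = λ _ → count (a ∷ as)} (λ _ → count-step px as) d n ⟨
  count (a ∷ as) n             ∎
  where
  open ≡-Reasoning
  as = map proj₁ xs

-- Growth of counts

shift-nonneg : ∀ a {f} n → (∀ m → 0ℚ Q.≤ f m) → 0ℚ Q.≤ shift a f n
shift-nonneg a {f} n 0≤f = subst (Q._≤ shift a f n) (shift-0 a n) (shift-mono a n 0≤f)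

iterate-nonneg : ∀ b x {g} → (∀ d n → 0ℚ Q.≤ g d n) → ∀ d n → 0ℚ Q.≤ iterate b x g d n
iterate-nonneg zero    x 0≤g d n = 0≤g d n
iterate-nonneg (suc b) x@(a , t) 0≤g d n =
  ℚP.+-mono-≤ (0≤g d n) (shift-nonneg a n (iterate-nonneg b x 0≤g (d ℤ.+ t)))

F-nonneg : ∀ {g} → (∀ d n → 0ℚ Q.≤ g d n) → ∀ xs d n → 0ℚ Q.≤ F g xs d n
F-nonneg 0≤g []       d n = 0≤g d n
F-nonneg 0≤g (x ∷ xs) d n = iterate-nonneg n x (F-nonneg 0≤g xs) d n

δ-nonneg : ∀ d n → 0ℚ Q.≤ δ d n
δ-nonneg d zero    = 0≤toℚ 1
δ-nonneg d (suc n) = ℚP.≤-refl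

count-nonneg : ∀ as n → 0ℚ Q.≤ count as n
count-nonneg as = F-nonneg δ-nonneg (map neutral as) (+ 0)

shift-≤-bound : ∀ a {f c} n → 0ℚ Q.≤ c → (∀ m → m ≤ n → f m Q.≤ c) → shift a f n Q.≤ c
shift-≤-bound zero    n       0≤c f≤c = f≤c n ℕP.≤-refl
shift-≤-bound (suc a) zero    0≤c f≤c = 0≤c
shift-≤-bound (suc a) (suc n) 0≤c f≤c = shift-≤-bound a n 0≤c λ m m≤n → f≤c m (ℕP.m≤n⇒m≤1+n m≤n)

shift-<-bound : ∀ {a} → 0 < a → ∀ {f c} n → 0ℚ Q.≤ c → (∀ m → m < n → f m Q.≤ c) → shift a f n Q.≤ c
shift-<-bound {suc a} _ zero    0≤c f≤c = 0≤c
shift-<-bound {suc a} _ (suc n) 0≤c f≤c = shift-≤-bound a n 0≤c λ m m≤n → f≤c m (s≤s m≤n)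

power : ℕ → ℕ → ℚ
power k n = toℚ (suc n ℕ.^ k)

power-nonneg : ∀ k n → 0ℚ Q.≤ power k n
power-nonneg k n = 0≤toℚ (suc n ℕ.^ k)

power-suc : ∀ k n → power (suc k) n ≡ toℚ (suc n) * power k n
power-suc k n = toℚ-* (suc n) (suc n ℕ.^ k)

-- All multiplicities but one are at most `n`, and they leave at most one choice for the last. In
-- the recursion this is the splitting of (n+1)^(k+1) as (n+1)^k + n (n+1)^k.
count-≤-power : ∀ {a as} → Positive (a ∷ as) → ∀ n → count (a ∷ as) n Q.≤ power (length as) n
count-≤-power {a} {as} (pa ∷ pas) n = go as pas (suc n) n ℕP.≤-refl
  where
  go : ∀ as → Positive as → ∀ N n → n < N → count (a ∷ as) n Q.≤ power (length as) n
  go [] _ (suc N) zero _ = ℚP.≤-reflexive (count-below pa [] pa)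
  go [] _ (suc N) (suc n) (s≤s n<N) = begin
    count (a ∷ []) (suc n)                 ≡⟨ count-step pa [] (suc n) ⟩
    0ℚ + shift a (count (a ∷ [])) (suc n)  ≡⟨ ℚP.+-identityˡ _ ⟩
    shift a (count (a ∷ [])) (suc n)       ≤⟨ shift-<-bound pa (suc n) (0≤toℚ 1) (λ m m≤n → go [] [] N m (ℕP.<-≤-trans m≤n n<N)) ⟩
    1ℚ                                     ∎
    where open ℚP.≤-Reasoning
  go (b ∷ as) (pb ∷ pas) (suc N) n (s≤s n≤N) = begin
    count (a ∷ b ∷ as) n
      ≡⟨ count-step pa (b ∷ as) n ⟩
    count (b ∷ as) n + shift a (count (a ∷ b ∷ as)) n
      -- The indices m reached by the shift are below `n`, so the inductive bound (m+1)^(k+1) is at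
      -- most n^(k+1).
      ≤⟨ ℚP.+-mono-≤ (count-≤-power (pb ∷ pas) n) (shift-<-bound pa n (0≤toℚ (n ℕ.^ suc k)) λ m m<n →
           ℚP.≤-trans (go (b ∷ as) (pb ∷ pas) N m (ℕP.<-≤-trans m<n n≤N)) (toℚ-mono-≤ (ℕP.^-monoˡ-≤ (suc k) m<n))) ⟩
    power k n + toℚ (n ℕ.* n ℕ.^ k)
      ≤⟨ ℚP.+-monoʳ-≤ (power k n) (toℚ-mono-≤ (ℕP.*-monoʳ-≤ n (ℕP.^-monoˡ-≤ k (ℕP.n≤1+n n)))) ⟩
    power k n + toℚ (n ℕ.* suc n ℕ.^ k)
      ≡⟨ toℚ-+ (suc n ℕ.^ k) (n ℕ.* suc n ℕ.^ k) ⟨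
    power (suc k) n ∎
    where
    open ℚP.≤-Reasoning
    k = length as

-- f n = O(n ^ (k - 1)); multiplying by n keeps the exponent natural when k = 0.
record Small (k : ℕ) (f : ℕ → ℚ) : Set where
  constructor small
  field
    C        : ℚ
    0≤C      : 0ℚ Q.≤ C
    estimate : ∀ n → toℚ n * ∣ f n ∣ Q.≤ C * power k n

Small-cong : ∀ {k f g} → (∀ n → f n ≡ g n) → Small k f → Small k g
Small-cong {k} f≗g (small C 0≤C e) =
  small C 0≤C λ n → subst (λ q → toℚ n * ∣ q ∣ Q.≤ C * power k n) (f≗g n) (e n)

Small-0 : ∀ {k} → Small k (λ _ → 0ℚ)
Small-0 {k} = small 0ℚ ℚP.≤-refl λ n →
  ℚP.≤-reflexive (trans (ℚP.*-zeroʳ (toℚ n)) (sym (ℚP.*-zeroˡ (power k n))))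

Small-+ : ∀ {k f g} → Small k f → Small k g → Small k (λ n → f n + g n)
Small-+ {k} {f} {g} (small C 0≤C e) (small C′ 0≤C′ e′) = small (C + C′) (ℚP.+-mono-≤ 0≤C 0≤C′) λ n → begin
  toℚ n * ∣ f n + g n ∣                ≤⟨ *-monoˡ (0≤toℚ n) (ℚP.∣p+q∣≤∣p∣+∣q∣ (f n) (g n)) ⟩
  toℚ n * (∣ f n ∣ + ∣ g n ∣)          ≡⟨ ℚP.*-distribˡ-+ (toℚ n) ∣ f n ∣ ∣ g n ∣ ⟩
  toℚ n * ∣ f n ∣ + toℚ n * ∣ g n ∣    ≤⟨ ℚP.+-mono-≤ (e n) (e′ n) ⟩
  C * power k n + C′ * power k n       ≡⟨ ℚP.*-distribʳ-+ (power k n) C C′ ⟨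
  (C + C′) * power k n                 ∎
  where open ℚP.≤-Reasoning

Small-* : ∀ c {k f} → Small k f → Small k (λ n → c * f n)
Small-* c {k} {f} (small C 0≤C e) = small (∣ c ∣ * C) (0≤p*q (ℚP.0≤∣p∣ c) 0≤C) λ n → begin
  toℚ n * ∣ c * f n ∣          ≡⟨ cong (toℚ n *_) (ℚP.∣p*q∣≡∣p∣*∣q∣ c (f n)) ⟩
  toℚ n * (∣ c ∣ * ∣ f n ∣)    ≡⟨ lem (toℚ n) ∣ c ∣ ∣ f n ∣ ⟩
  ∣ c ∣ * (toℚ n * ∣ f n ∣)    ≤⟨ *-monoˡ (ℚP.0≤∣p∣ c) (e n) ⟩
  ∣ c ∣ * (C * power k n)      ≡⟨ ℚP.*-assoc ∣ c ∣ C (power k n) ⟨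
  ∣ c ∣ * C * power k n        ∎
  where
  open ℚP.≤-Reasoning
  lem : ∀ a b c → a * (b * c) ≡ b * (a * c)
  lem = solve-∀ ℚ-ring

Small-- : ∀ {k f g} → Small k f → Small k g → Small k (λ n → f n - g n)
Small-- {k} {f} {g} sf sg = Small-cong (λ n → lem (f n) (g n)) (Small-+ sf (Small-* (- 1ℚ) sg))
  where
  lem : ∀ x y → x + - 1ℚ * y ≡ x - y
  lem = solve-∀ ℚ-ring

^-distribʳ-* : ∀ k m n → (m ℕ.* n) ℕ.^ k ≡ m ℕ.^ k ℕ.* n ℕ.^ k
^-distribʳ-* zero    m n = refl
^-distribʳ-* (suc k) m n =
  trans (cong (m ℕ.* n ℕ.*_) (^-distribʳ-* k m n)) (ℕP.[m*n]*[o*p]≡[m*o]*[n*p] m n (m ℕ.^ k) (n ℕ.^ k))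

-- Since 1 + d + n ≤ (1 + d)(1 + n), a translation costs only a constant factor, and `Small` is
-- stable under it.
power-+ : ∀ k d n → power k (d ℕ.+ n) Q.≤ toℚ (suc d ℕ.^ k) * power k n
power-+ k d n = begin
  toℚ (suc (d ℕ.+ n) ℕ.^ k)              ≤⟨ toℚ-mono-≤ (ℕP.^-monoˡ-≤ k (s≤s d+n≤)) ⟩
  toℚ ((suc d ℕ.* suc n) ℕ.^ k)          ≡⟨ cong toℚ (^-distribʳ-* k (suc d) (suc n)) ⟩
  toℚ (suc d ℕ.^ k ℕ.* suc n ℕ.^ k)      ≡⟨ toℚ-* (suc d ℕ.^ k) (suc n ℕ.^ k) ⟩
  toℚ (suc d ℕ.^ k) * power k n          ∎
  where
  open ℚP.≤-Reasoning
  d+n≤ : d ℕ.+ n ≤ n ℕ.+ d ℕ.* suc n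
  d+n≤ = subst (_≤ n ℕ.+ d ℕ.* suc n) (ℕP.+-comm n d) (ℕP.+-monoʳ-≤ n (ℕP.m≤m*n d (suc n)))

Small-translate : ∀ d {k f} → Small k f → Small k (λ n → f (d ℕ.+ n))
Small-translate d {k} {f} (small C 0≤C e) = small (C * toℚ (suc d ℕ.^ k)) (0≤p*q 0≤C (0≤toℚ (suc d ℕ.^ k))) λ n → begin
  toℚ n * ∣ f (d ℕ.+ n) ∣              ≤⟨ *-monoʳ (ℚP.0≤∣p∣ (f (d ℕ.+ n))) (toℚ-mono-≤ (ℕP.m≤n+m n d)) ⟩
  toℚ (d ℕ.+ n) * ∣ f (d ℕ.+ n) ∣      ≤⟨ e (d ℕ.+ n) ⟩
  C * power k (d ℕ.+ n)                ≤⟨ *-monoˡ 0≤C (power-+ k d n) ⟩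
  C * (toℚ (suc d ℕ.^ k) * power k n)  ≡⟨ ℚP.*-assoc C (toℚ (suc d ℕ.^ k)) (power k n) ⟨
  C * toℚ (suc d ℕ.^ k) * power k n    ∎
  where open ℚP.≤-Reasoning

Small-≤ : ∀ {k f g} → (∀ n → 0ℚ Q.≤ f n) → (∀ n → f n Q.≤ g n) → Small k g → Small k f
Small-≤ {k} {f} {g} 0≤f f≤g (small C 0≤C e) = small C 0≤C λ n → ℚP.≤-trans (*-monoˡ (0≤toℚ n)
  (subst₂ Q._≤_ (sym (ℚP.0≤p⇒∣p∣≡p (0≤f n))) (sym (ℚP.0≤p⇒∣p∣≡p (ℚP.≤-trans (0≤f n) (f≤g n)))) (f≤g n))) (e n)

count-Small : ∀ {as k} → Positive as → length as ≡ k → Small k (count as)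
count-Small {[]} [] refl = small 1ℚ (0≤toℚ 1) estimate
  where
  estimate : ∀ n → toℚ n * ∣ δ (+ 0) n ∣ Q.≤ 1ℚ * power 0 n
  -- The empty count is supported at 0, where the factor `toℚ n` removes it.
  estimate zero    = 0≤toℚ 1
  estimate (suc n) = subst (Q._≤ 1ℚ) (sym (ℚP.*-zeroʳ (toℚ (suc n)))) (0≤toℚ 1)
count-Small {a ∷ as} pas refl = small 1ℚ (0≤toℚ 1) λ n → begin
  toℚ n * ∣ count (a ∷ as) n ∣    ≡⟨ cong (toℚ n *_) (ℚP.0≤p⇒∣p∣≡p (count-nonneg (a ∷ as) n)) ⟩
  toℚ n * count (a ∷ as) n        ≤⟨ *-monoˡ (0≤toℚ n) (count-≤-power pas n) ⟩
  toℚ n * power k n               ≤⟨ *-monoʳ (power-nonneg k n) (toℚ-mono-≤ (ℕP.n≤1+n n)) ⟩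
  toℚ (suc n) * power k n         ≡⟨ power-suc k n ⟨
  power (suc k) n                 ≡⟨ ℚP.*-identityˡ (power (suc k) n) ⟨
  1ℚ * power (suc k) n            ∎
  where
  open ℚP.≤-Reasoning
  k = length as

-- Equality up to lower order

infix 4 _≈[_]_
-- A record, so that `f` and `g` are arguments of a type constructor and can be inferred.
record _≈[_]_ (f : ℕ → ℚ) (k : ℕ) (g : ℕ → ℚ) : Set where
  constructor asymp
  field difference : Small k (λ n → f n - g n)

≈-refl : ∀ {k f} → f ≈[ k ] f
≈-refl {f = f} = asymp (Small-cong (λ n → sym (ℚP.+-inverseʳ (f n))) Small-0)

≈-trans : ∀ {k f g h} → f ≈[ k ] g → g ≈[ k ] h → f ≈[ k ] h
≈-trans {f = f} {g} {h} (asymp s) (asymp s′) = asymp (Small-cong (λ n → lem (f n) (g n) (h n)) (Small-+ s s′))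
  where
  lem : ∀ x y z → (x - y) + (y - z) ≡ x - z
  lem = solve-∀ ℚ-ring

≈-sym : ∀ {k f g} → f ≈[ k ] g → g ≈[ k ] f
≈-sym {f = f} {g} (asymp s) = asymp (Small-cong (λ n → lem (f n) (g n)) (Small-* (- 1ℚ) s))
  where
  lem : ∀ x y → - 1ℚ * (x - y) ≡ y - x
  lem = solve-∀ ℚ-ring

≈-* : ∀ c {k f g} → f ≈[ k ] g → (λ n → c * f n) ≈[ k ] (λ n → c * g n)
≈-* c {f = f} {g} (asymp s) = asymp (Small-cong (λ n → lem c (f n) (g n)) (Small-* c s))
  where
  lem : ∀ c x y → c * (x - y) ≡ c * x - c * y
  lem = solve-∀ ℚ-ring

≈-+ : ∀ {k f f′ g g′} → f ≈[ k ] g → f′ ≈[ k ] g′ → (λ n → f n + f′ n) ≈[ k ] (λ n → g n + g′ n)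
≈-+ {f = f} {f′} {g} {g′} (asymp s) (asymp s′) =
  asymp (Small-cong (λ n → lem (f n) (f′ n) (g n) (g′ n)) (Small-+ s s′))
  where
  lem : ∀ a b c d → (a - c) + (b - d) ≡ (a + b) - (c + d)
  lem = solve-∀ ℚ-ring

≈-cong : ∀ {k f f′ g g′} → (∀ n → f n ≡ f′ n) → (∀ n → g n ≡ g′ n) → f ≈[ k ] g → f′ ≈[ k ] g′
≈-cong f≗f′ g≗g′ (asymp s) = asymp (Small-cong (λ n → cong₂ _-_ (f≗f′ n) (g≗g′ n)) s)

-- Replacing a part by 1

-- Stated by common divisors: in this form it passes through permutations and the merging of two
-- parts without computing a gcd.
Coprime : List ℕ → Set
Coprime as = ∀ d → All (d ∣_) as → d ≡ 1

gcdAll-∣ : ∀ as → All (gcdAll as ∣_) as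
gcdAll-∣ []       = []
gcdAll-∣ (a ∷ as) =
  gcd[m,n]∣m a (gcdAll as) ∷ All.map (∣-trans (gcd[m,n]∣n a (gcdAll as))) (gcdAll-∣ as)

∣-gcdAll : ∀ {d as} → All (d ∣_) as → d ∣ gcdAll as
∣-gcdAll {d} []     = d ∣0
∣-gcdAll (d∣a ∷ d∣as) = gcd-greatest d∣a (∣-gcdAll d∣as)

gcdAll≡1⇒Coprime : ∀ {as} → gcdAll as ≡ 1 → Coprime as
gcdAll≡1⇒Coprime eq d d∣as = ∣1⇒≡1 (subst (d ∣_) eq (∣-gcdAll d∣as))

Coprime⇒gcdAll≡1 : ∀ {as} → Coprime as → gcdAll as ≡ 1
Coprime⇒gcdAll≡1 {as} cop = cop (gcdAll as) (gcdAll-∣ as)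

Coprime-↭ : ∀ {as bs} → as ↭ bs → Coprime as → Coprime bs
Coprime-↭ p cop d d∣bs = cop d (All-resp-↭ (Perm.↭-sym p) d∣bs)

module _ (P : ℕ → Set) (P-0 : P 0) (P-+ : ∀ {x y} → P x → P y → P (x ℕ.+ y)) where

  multiples : ∀ c {x} → P x → P (c ℕ.* x)
  multiples zero    px = P-0
  multiples (suc c) px = P-+ px (multiples c px)

  -- Without subtraction in ℕ, the gcd is realised as the difference of two members of the
  -- additively closed `P`.
  bézout : ∀ {as} → All P as → ∃ λ y → P y × P (gcdAll as ℕ.+ y)
  bézout [] = 0 , P-0 , P-0
  bézout {a ∷ as} (pa ∷ pas) with bézout pas
  ... | y , py , pg+y with Bézout.identity (gcd-GCD a (gcdAll as))
  -- Here u a = d + v g, so the members `u a + v y` and `v (g + y)` differ by d.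
  ...   | Bézout.+- u v eq = v ℕ.* (g ℕ.+ y) , multiples v pg+y , subst P lhs (P-+ (multiples u pa) (multiples v py))
    where
    g = gcdAll as
    d = gcd a g
    open ≡-Reasoning
    lhs : u ℕ.* a ℕ.+ v ℕ.* y ≡ d ℕ.+ v ℕ.* (g ℕ.+ y)
    lhs = begin
      u ℕ.* a ℕ.+ v ℕ.* y               ≡⟨ cong (ℕ._+ v ℕ.* y) eq ⟨
      d ℕ.+ v ℕ.* g ℕ.+ v ℕ.* y         ≡⟨ ℕP.+-assoc d (v ℕ.* g) (v ℕ.* y) ⟩
      d ℕ.+ (v ℕ.* g ℕ.+ v ℕ.* y)       ≡⟨ cong (d ℕ.+_) (ℕP.*-distribˡ-+ v g y) ⟨
      d ℕ.+ v ℕ.* (g ℕ.+ y)             ∎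
  -- Here v g = d + u a, and the two members exchange roles.
  ...   | Bézout.-+ u v eq = u ℕ.* a ℕ.+ v ℕ.* y , P-+ (multiples u pa) (multiples v py) , subst P lhs (multiples v pg+y)
    where
    g = gcdAll as
    d = gcd a g
    open ≡-Reasoning
    lhs : v ℕ.* (g ℕ.+ y) ≡ d ℕ.+ (u ℕ.* a ℕ.+ v ℕ.* y)
    lhs = begin
      v ℕ.* (g ℕ.+ y)                   ≡⟨ ℕP.*-distribˡ-+ v g y ⟩
      v ℕ.* g ℕ.+ v ℕ.* y               ≡⟨ cong (ℕ._+ v ℕ.* y) eq ⟨
      d ℕ.+ u ℕ.* a ℕ.+ v ℕ.* y         ≡⟨ ℕP.+-assoc d (u ℕ.* a) (v ℕ.* y) ⟩
      d ℕ.+ (u ℕ.* a ℕ.+ v ℕ.* y)       ∎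

AlmostPeriod : ℕ → (ℕ → ℚ) → ℕ → Set
AlmostPeriod k f x = (λ n → f (x ℕ.+ n)) ≈[ k ] f

module _ {k : ℕ} {f : ℕ → ℚ} where

  AlmostPeriod-0 : AlmostPeriod k f 0
  AlmostPeriod-0 = ≈-refl

  AlmostPeriod-+ : ∀ {x y} → AlmostPeriod k f x → AlmostPeriod k f y → AlmostPeriod k f (x ℕ.+ y)
  AlmostPeriod-+ {x} {y} (asymp s) s′ =
    ≈-trans (≈-cong (λ n → cong f (sym (ℕP.+-assoc x y n))) (λ _ → refl) (asymp (Small-translate y s))) s′

  -- The period y brings f(n + 1) near f(n + 1 + y), and the period y + 1 brings that near f(n).
  AlmostPeriod-1 : ∀ {y} → AlmostPeriod k f y → AlmostPeriod k f (suc y) → AlmostPeriod k f 1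
  AlmostPeriod-1 {y} (asymp s) s′ =
    ≈-trans (≈-sym (asymp (Small-translate 1 s))) (≈-cong (λ n → cong f (sym (ℕP.+-suc y n))) (λ _ → refl) s′)

  AlmostPeriod-all : AlmostPeriod k f 1 → ∀ x → AlmostPeriod k f x
  AlmostPeriod-all s zero    = AlmostPeriod-0
  AlmostPeriod-all s (suc x) = AlmostPeriod-+ {1} {x} s (AlmostPeriod-all s x)

AlmostPeriod-cong : ∀ {k f g x} → (∀ n → f n ≡ g n) → AlmostPeriod k f x → AlmostPeriod k g x
AlmostPeriod-cong {x = x} f≗g = ≈-cong (λ n → f≗g (x ℕ.+ n)) f≗g

-- The difference is exactly the count without the part `a`, taken at a + n.
head-AlmostPeriod : ∀ {a as k} → Positive (a ∷ as) → length as ≡ k → AlmostPeriod k (count (a ∷ as)) a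
head-AlmostPeriod {a} {as} (pa ∷ pas) len =
  asymp (Small-cong (λ n → sym (eq n)) (Small-translate a (count-Small pas len)))
  where
  lem : ∀ x y → (x + y) - y ≡ x
  lem = solve-∀ ℚ-ring
  eq : ∀ n → count (a ∷ as) (a ℕ.+ n) - count (a ∷ as) n ≡ count as (a ℕ.+ n)
  eq n = trans (cong (_- count (a ∷ as) n) (count-above pa as n)) (lem (count as (a ℕ.+ n)) (count (a ∷ as) n))

part-AlmostPeriod : ∀ {as k} → Positive as → length as ≡ suc k → ∀ {b} → b ∈ as → AlmostPeriod k (count as) b
part-AlmostPeriod {as} {k} pas len {b} b∈as with ∈-∃++ b∈as
... | xs , ys , refl = AlmostPeriod-cong (λ n → sym (count-↭ pas perm n))
  (head-AlmostPeriod (All-resp-↭ perm pas) (ℕP.suc-injective (trans (sym (PermP.↭-length perm)) len)))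
  where
  perm : xs ++ [ b ] ++ ys ↭ b ∷ xs ++ ys
  perm = PermP.shift b xs ys

-- The almost periods are closed under addition, so Bézout provides two that differ by gcd = 1.
count-AlmostPeriod : ∀ {as k} → Positive as → Coprime as → length as ≡ suc k → ∀ x → AlmostPeriod k (count as) x
count-AlmostPeriod {as} {k} pas cop len
  with bézout (AlmostPeriod k (count as)) AlmostPeriod-0 (λ {x} {y} → AlmostPeriod-+ {x = x} {y})
              (All.tabulate (part-AlmostPeriod pas len))
... | y , py , p1+y = AlmostPeriod-all (AlmostPeriod-1 {y = y} py
  (subst (λ g → AlmostPeriod k (count as) (g ℕ.+ y)) (Coprime⇒gcdAll≡1 cop) p1+y))

-- Sliding sums of a count

window : ℕ → (ℕ → ℚ) → ℕ → ℚ
window zero    f n = 0ℚ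
window (suc a) f n = f (a ℕ.+ n) + window a f n

window-slide : ∀ a f n → f n + window a f (suc n) ≡ f (a ℕ.+ n) + window a f n
window-slide zero    f n = refl
window-slide (suc a) f n = begin
  f n + (f (a ℕ.+ suc n) + window a f (suc n))  ≡⟨ lem (f n) (f (a ℕ.+ suc n)) (window a f (suc n)) ⟩
  f (a ℕ.+ suc n) + (f n + window a f (suc n))  ≡⟨ cong₂ _+_ (cong f (ℕP.+-suc a n)) (window-slide a f n) ⟩
  f (suc a ℕ.+ n) + (f (a ℕ.+ n) + window a f n) ∎
  where
  open ≡-Reasoning
  lem : ∀ x y z → x + (y + z) ≡ y + (x + z)
  lem = solve-∀ ℚ-ring

window-≈ : ∀ a {k f} → (∀ x → AlmostPeriod k f x) → window a f ≈[ k ] (λ n → toℚ a * f n)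
window-≈ zero {f = f} ap = ≈-cong (λ _ → refl) (λ n → sym (ℚP.*-zeroˡ (f n))) ≈-refl
window-≈ (suc a) {f = f} ap = ≈-cong (λ _ → refl)
  (λ n → trans (lem (f n) (toℚ a)) (cong (_* f n) (sym (toℚ-suc a)))) (≈-+ (ap a) (window-≈ a ap))
  where
  lem : ∀ x y → x + y * x ≡ (1ℚ + y) * x
  lem = solve-∀ ℚ-ring

+-cancelˡ : ∀ x {y z} → x + y ≡ x + z → y ≡ z
+-cancelˡ x {y} {z} eq = trans (lem x y) (trans (cong (λ w → - x + w) eq) (sym (lem x z)))
  where
  lem : ∀ x y → y ≡ - x + (x + y)
  lem = solve-∀ ℚ-ring

-- In generating functions this is (1 - x^(a+1))/(1 - x) = 1 + x + ... + x^a. The argument on the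
-- right is `a + n` because that is where the window starting at `n` ends.
window-count : ∀ {a} → 0 < suc a → ∀ as n → window (suc a) (count (suc a ∷ as)) n ≡ count (1 ∷ as) (a ℕ.+ n)
window-count {a} pa as = go
  where
  open ≡-Reasoning
  u = count (suc a ∷ as)
  v = count (1 ∷ as)
  w = count as
  p1 : 0 < 1
  p1 = s≤s z≤n
  -- Up to index `a` the part `suc a` cannot occur, so `u` agrees with `w` there, and `v` is the
  -- running sum of `w`.
  base : ∀ j → j ≤ a → window (suc j) u 0 ≡ v j
  base zero j≤a = begin
    u 0 + 0ℚ ≡⟨ ℚP.+-identityʳ (u 0) ⟩
    u 0      ≡⟨ count-below pa as pa ⟩
    w 0      ≡⟨ count-below p1 as p1 ⟨
    v 0      ∎
  base (suc j) j<a = begin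
    u (suc j ℕ.+ 0) + window (suc j) u 0  ≡⟨ cong₂ _+_ (cong u (ℕP.+-identityʳ (suc j))) (base j (ℕP.<⇒≤ j<a)) ⟩
    u (suc j) + v j                       ≡⟨ cong (_+ v j) (count-below pa as (s≤s j<a)) ⟩
    w (suc j) + v j                       ≡⟨ count-above p1 as j ⟨
    v (suc j)                             ∎
  lem : ∀ x y z → (x + y) + z ≡ y + (x + z)
  lem = solve-∀ ℚ-ring
  go : ∀ n → window (suc a) u n ≡ v (a ℕ.+ n)
  go zero    = trans (base a ℕP.≤-refl) (cong v (sym (ℕP.+-identityʳ a)))
  go (suc n) = +-cancelˡ (u n) (begin
    u n + window (suc a) u (suc n)          ≡⟨ window-slide (suc a) u n ⟩
    u (suc a ℕ.+ n) + window (suc a) u n    ≡⟨ cong₂ _+_ (count-above pa as n) (go n) ⟩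
    w (suc a ℕ.+ n) + u n + v (a ℕ.+ n)     ≡⟨ lem (w (suc a ℕ.+ n)) (u n) (v (a ℕ.+ n)) ⟩
    u n + (w (suc a ℕ.+ n) + v (a ℕ.+ n))   ≡⟨ cong (_+_ (u n)) (count-above p1 as (a ℕ.+ n)) ⟨
    u n + v (suc (a ℕ.+ n))                 ≡⟨ cong (λ m → u n + v m) (ℕP.+-suc a n) ⟨
    u n + v (a ℕ.+ suc n)                   ∎)

part→1 : ∀ {a as k} → Positive (a ∷ as) → Coprime (a ∷ as) → length as ≡ k →
  (λ n → toℚ a * count (a ∷ as) n) ≈[ k ] count (1 ∷ as)
part→1 {suc a} {as} {k} (pa ∷ pas) cop len = ≈-trans
  (≈-sym (window-≈ (suc a) (count-AlmostPeriod (pa ∷ pas) cop (cong suc len))))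
  (≈-cong (λ n → sym (window-count pa as n)) (λ _ → refl)
    -- The window gives a value at `a + n`. With a part 1 present, 1 is an almost period, hence so
    -- is `a`, which leads back to `n`.
    (AlmostPeriod-all (head-AlmostPeriod (s≤s z≤n ∷ pas) len) a))

∏ : List ℕ → ℚ
∏ as = prodℚ (map toℚ as)

ones : ℕ → List ℕ
ones i = replicate i 1

-- `i` parts have been replaced already and have contributed their factors; `∏ as` holds the factors
-- still to be used.
count-≈-ones : ∀ as i {k} → Positive as → Coprime (ones i ++ as) → i ℕ.+ length as ≡ suc k →
  (λ n → ∏ as * count (ones i ++ as) n) ≈[ k ] count (ones (suc k))
count-≈-ones [] i {k} _ _ len = ≈-cong (λ n → trans (sym (cong (λ l → count l n) eq)) (sym (ℚP.*-identityˡ _))) (λ _ → refl) ≈-refl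
  where
  eq : ones i ++ [] ≡ ones (suc k)
  eq = trans (++-identityʳ (ones i)) (cong ones (trans (sym (ℕP.+-identityʳ i)) len))
count-≈-ones (b ∷ as) i {k} (pb ∷ pas) cop len = ≈-trans
  (≈-cong (λ n → eq n) (λ _ → refl) (≈-* (∏ as) (part→1 (pb ∷ p1+as) (Coprime-↭ perm cop) len′)))
  -- A list containing 1 is coprime, so the invariant costs nothing from here on.
  (count-≈-ones as (suc i) pas (λ { d (d∣1 ∷ _) → ∣1⇒≡1 d∣1 }) (trans (sym (ℕP.+-suc i (length as))) len))
  where
  p1+as : Positive (ones i ++ as)
  p1+as = AllP.++⁺ (AllP.replicate⁺ i (s≤s z≤n)) pas
  perm : ones i ++ b ∷ as ↭ b ∷ ones i ++ as
  perm = PermP.shift b (ones i) as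
  len′ : length (ones i ++ as) ≡ k
  len′ = ℕP.suc-injective (begin
    suc (length (ones i ++ as))             ≡⟨ cong suc (length-++ (ones i)) ⟩
    suc (length (ones i) ℕ.+ length as)     ≡⟨ cong (λ j → suc (j ℕ.+ length as)) (length-replicate i) ⟩
    suc (i ℕ.+ length as)                   ≡⟨ ℕP.+-suc i (length as) ⟨
    i ℕ.+ suc (length as)                   ≡⟨ len ⟩
    suc k                                   ∎)
    where open ≡-Reasoning
  lem : ∀ x y z → x * (y * z) ≡ y * x * z
  lem = solve-∀ ℚ-ring
  eq : ∀ n → ∏ as * (toℚ b * count (b ∷ ones i ++ as) n) ≡ ∏ (b ∷ as) * count (ones i ++ b ∷ as) n
  eq n = trans (lem (∏ as) (toℚ b) (count (b ∷ ones i ++ as) n))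
    (cong (∏ (b ∷ as) *_) (sym (count-↭ (All-resp-↭ (Perm.↭-sym perm) (pb ∷ p1+as)) perm n)))

-- Divided differences

-- Up to the sign (-1)^(length rs ∸ 1), the divided difference of w at the nodes rs.
divDiff : (ℚ → ℚ) → List ℚ → ℚ
divDiff w []       = 0ℚ
divDiff w (r ∷ rs) = w r * prodℚ (map (λ x → inv (x - r)) rs) + divDiff (λ x → w x * inv (r - x)) rs

divDiff-cong : ∀ {w w′ rs} → All (λ x → w x ≡ w′ x) rs → divDiff w rs ≡ divDiff w′ rs
divDiff-cong []         = refl
divDiff-cong {rs = r ∷ rs} (eq ∷ eqs) = cong₂ _+_
  (cong (_* prodℚ (map (λ x → inv (x - r)) rs)) eq)
  (divDiff-cong (All.map (λ {x} e → cong (_* inv (r - x)) e) eqs))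

divDiff-linear : ∀ a b w w′ rs → divDiff (λ x → a * w x + b * w′ x) rs ≡ a * divDiff w rs + b * divDiff w′ rs
divDiff-linear a b w w′ [] = lem a b
  where
  lem : ∀ a b → 0ℚ ≡ a * 0ℚ + b * 0ℚ
  lem = solve-∀ ℚ-ring
divDiff-linear a b w w′ (r ∷ rs) = begin
  (a * w r + b * w′ r) * P + divDiff (λ x → (a * w x + b * w′ x) * inv (r - x)) rs
    ≡⟨ cong (_+_ ((a * w r + b * w′ r) * P)) (divDiff-cong (All.universal (λ x → lem a b (w x) (w′ x) (inv (r - x))) rs)) ⟩
  (a * w r + b * w′ r) * P + divDiff (λ x → a * (w x * inv (r - x)) + b * (w′ x * inv (r - x))) rs
    ≡⟨ cong (_+_ ((a * w r + b * w′ r) * P)) (divDiff-linear a b _ _ rs) ⟩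
  (a * w r + b * w′ r) * P + (a * D + b * D′)
    ≡⟨ lem₂ a b (w r) (w′ r) P D D′ ⟩
  a * (w r * P + D) + b * (w′ r * P + D′) ∎
  where
  open ≡-Reasoning
  P = prodℚ (map (λ x → inv (x - r)) rs)
  D = divDiff (λ x → w x * inv (r - x)) rs
  D′ = divDiff (λ x → w′ x * inv (r - x)) rs
  lem : ∀ a b x y z → (a * x + b * y) * z ≡ a * (x * z) + b * (y * z)
  lem = solve-∀ ℚ-ring
  lem₂ : ∀ a b x y p d d′ → (a * x + b * y) * p + (a * d + b * d′) ≡ a * (x * p + d) + b * (y * p + d′)
  lem₂ = solve-∀ ℚ-ring

divDiff-* : ∀ a w rs → divDiff (λ x → a * w x) rs ≡ a * divDiff w rs
divDiff-* a w rs = begin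
  divDiff (λ x → a * w x) rs               ≡⟨ divDiff-cong (All.universal (λ x → lem a (w x) (w x)) rs) ⟩
  divDiff (λ x → a * w x + 0ℚ * w x) rs    ≡⟨ divDiff-linear a 0ℚ w w rs ⟩
  a * divDiff w rs + 0ℚ * divDiff w rs     ≡⟨ lem a (divDiff w rs) (divDiff w rs) ⟨
  a * divDiff w rs                         ∎
  where
  open ≡-Reasoning
  lem : ∀ a x y → a * x ≡ a * x + 0ℚ * y
  lem = solve-∀ ℚ-ring

x≢y⇒x-y≢0 : ∀ {x y} → x ≢ y → x - y ≢ 0ℚ
x≢y⇒x-y≢0 {x} {y} x≢y eq = x≢y (begin
  x              ≡⟨ lem x y ⟩
  (x - y) + y    ≡⟨ cong (_+ y) eq ⟩
  0ℚ + y         ≡⟨ ℚP.+-identityˡ y ⟩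
  y              ∎)
  where
  open ≡-Reasoning
  lem : ∀ x y → x ≡ (x - y) + y
  lem = solve-∀ ℚ-ring

-- Partial fractions: (r₂ - r₁) / ((r₁ - x)(r₂ - x)) = 1 / (r₁ - x) - 1 / (r₂ - x).
divDiff-rec : ∀ w r₁ r₂ rs → r₁ ≢ r₂ → All (r₁ ≢_) rs → All (r₂ ≢_) rs →
  (r₂ - r₁) * divDiff w (r₁ ∷ r₂ ∷ rs) ≡ divDiff w (r₁ ∷ rs) - divDiff w (r₂ ∷ rs)
divDiff-rec w r₁ r₂ rs r₁≢r₂ r₁∉ r₂∉ = begin
  (r₂ - r₁) * (w r₁ * (i * P₁) + (w r₂ * inv (r₁ - r₂) * P₂ + D₁₂))
    -- The factor at the node r₂ is oriented as r₁ - r₂; its sign turns the sum of the two leading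
    -- terms into a difference.
    ≡⟨ cong (λ j → (r₂ - r₁) * (w r₁ * (i * P₁) + (w r₂ * j * P₂ + D₁₂))) inv-swap ⟩
  (r₂ - r₁) * (w r₁ * (i * P₁) + (w r₂ * (- i) * P₂ + D₁₂))
    ≡⟨ lem r₁ r₂ (w r₁) (w r₂) i P₁ P₂ D₁₂ ⟩
  (r₂ - r₁) * i * (w r₁ * P₁ - w r₂ * P₂) + (r₂ - r₁) * D₁₂
    ≡⟨ cong₂ (λ u v → u * (w r₁ * P₁ - w r₂ * P₂) + v) (inv-inverseʳ (x≢y⇒x-y≢0 (λ e → r₁≢r₂ (sym e)))) D-eq ⟩
  1ℚ * (w r₁ * P₁ - w r₂ * P₂) + (1ℚ * D₁ + - 1ℚ * D₂)
    ≡⟨ lem₂ (w r₁ * P₁) (w r₂ * P₂) D₁ D₂ ⟩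
  (w r₁ * P₁ + D₁) - (w r₂ * P₂ + D₂) ∎
  where
  open ≡-Reasoning
  i = inv (r₂ - r₁)
  P₁ = prodℚ (map (λ x → inv (x - r₁)) rs)
  P₂ = prodℚ (map (λ x → inv (x - r₂)) rs)
  D₁ = divDiff (λ x → w x * inv (r₁ - x)) rs
  D₂ = divDiff (λ x → w x * inv (r₂ - x)) rs
  D₁₂ = divDiff (λ x → w x * inv (r₁ - x) * inv (r₂ - x)) rs
  neg-flip : ∀ x y → x - y ≡ - (y - x)
  neg-flip = solve-∀ ℚ-ring
  inv-swap : inv (r₁ - r₂) ≡ - i
  inv-swap = trans (cong inv (neg-flip r₁ r₂)) (inv-neg (r₂ - r₁))
  lem : ∀ r₁ r₂ u v i p q d → (r₂ - r₁) * (u * (i * p) + (v * (- i) * q + d)) ≡ (r₂ - r₁) * i * (u * p - v * q) + (r₂ - r₁) * d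
  lem = solve-∀ ℚ-ring
  lem₂ : ∀ a b c d → 1ℚ * (a - b) + (1ℚ * c + - 1ℚ * d) ≡ (a + c) - (b + d)
  lem₂ = solve-∀ ℚ-ring
  lem₃ : ∀ r₁ r₂ x y a b → (r₂ - r₁) * (y * a * b) ≡ (r₂ - x) * b * (y * a) - (r₁ - x) * a * (y * b)
  lem₃ = solve-∀ ℚ-ring
  lem₄ : ∀ a b → 1ℚ * a - 1ℚ * b ≡ 1ℚ * a + - 1ℚ * b
  lem₄ = solve-∀ ℚ-ring
  pointwise : ∀ x → r₁ ≢ x → r₂ ≢ x →
    (r₂ - r₁) * (w x * inv (r₁ - x) * inv (r₂ - x)) ≡ 1ℚ * (w x * inv (r₁ - x)) + - 1ℚ * (w x * inv (r₂ - x))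
  pointwise x r₁≢x r₂≢x = begin
    (r₂ - r₁) * (w x * inv (r₁ - x) * inv (r₂ - x))
      ≡⟨ lem₃ r₁ r₂ x (w x) (inv (r₁ - x)) (inv (r₂ - x)) ⟩
    (r₂ - x) * inv (r₂ - x) * (w x * inv (r₁ - x)) - (r₁ - x) * inv (r₁ - x) * (w x * inv (r₂ - x))
      ≡⟨ cong₂ (λ a b → a * (w x * inv (r₁ - x)) - b * (w x * inv (r₂ - x)))
           (inv-inverseʳ (x≢y⇒x-y≢0 r₂≢x)) (inv-inverseʳ (x≢y⇒x-y≢0 r₁≢x)) ⟩
    1ℚ * (w x * inv (r₁ - x)) - 1ℚ * (w x * inv (r₂ - x))
      ≡⟨ lem₄ (w x * inv (r₁ - x)) (w x * inv (r₂ - x)) ⟩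
    1ℚ * (w x * inv (r₁ - x)) + - 1ℚ * (w x * inv (r₂ - x)) ∎
  D-eq : (r₂ - r₁) * D₁₂ ≡ 1ℚ * D₁ + - 1ℚ * D₂
  D-eq = begin
    (r₂ - r₁) * D₁₂
      ≡⟨ divDiff-* (r₂ - r₁) (λ x → w x * inv (r₁ - x) * inv (r₂ - x)) rs ⟨
    divDiff (λ x → (r₂ - r₁) * (w x * inv (r₁ - x) * inv (r₂ - x))) rs
      ≡⟨ divDiff-cong (All.zipWith (λ {x} (a , b) → pointwise x a b) (r₁∉ , r₂∉)) ⟩
    divDiff (λ x → 1ℚ * (w x * inv (r₁ - x)) + - 1ℚ * (w x * inv (r₂ - x))) rs
      ≡⟨ divDiff-linear 1ℚ (- 1ℚ) _ _ rs ⟩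
    1ℚ * D₁ + - 1ℚ * D₂ ∎

*-cancelˡ : ∀ {a} → a ≢ 0ℚ → ∀ {x y} → a * x ≡ a * y → x ≡ y
*-cancelˡ {a} a≢0 {x} {y} eq = trans (expand x) (trans (cong (inv a *_) eq) (sym (expand y)))
  where
  lem : ∀ a i x → a * i * x ≡ i * (a * x)
  lem = solve-∀ ℚ-ring
  expand : ∀ x → x ≡ inv a * (a * x)
  expand x = trans (sym (ℚP.*-identityˡ x)) (trans (cong (_* x) (sym (inv-inverseʳ a≢0))) (lem a (inv a) x))

-- Lagrange interpolation of the constant 1, evaluated at 0.
divDiff-inv : ∀ w r rs → All (λ x → w x ≡ inv x) (r ∷ rs) → All (_≢ 0ℚ) (r ∷ rs) → Unique (r ∷ rs) →
  divDiff w (r ∷ rs) ≡ inv (prodℚ (r ∷ rs))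
divDiff-inv w r [] (eq ∷ []) _ _ = begin
  w r * 1ℚ + 0ℚ     ≡⟨ lem (w r) ⟩
  w r               ≡⟨ eq ⟩
  inv r             ≡⟨ cong inv (ℚP.*-identityʳ r) ⟨
  inv (r * 1ℚ)      ∎
  where
  open ≡-Reasoning
  lem : ∀ x → x * 1ℚ + 0ℚ ≡ x
  lem = solve-∀ ℚ-ring
divDiff-inv w r₁ (r₂ ∷ rs) (e₁ ∷ e₂ ∷ es) (n₁ ∷ n₂ ∷ ns) ((r₁≢r₂ ∷ r₁∉) ∷ r₂∉ ∷ u) =
  *-cancelˡ (x≢y⇒x-y≢0 (λ e → r₁≢r₂ (sym e))) (begin
  (r₂ - r₁) * divDiff w (r₁ ∷ r₂ ∷ rs)
    ≡⟨ divDiff-rec w r₁ r₂ rs r₁≢r₂ r₁∉ r₂∉ ⟩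
  divDiff w (r₁ ∷ rs) - divDiff w (r₂ ∷ rs)
    ≡⟨ cong₂ _-_ (divDiff-inv w r₁ rs (e₁ ∷ es) (n₁ ∷ ns) (r₁∉ ∷ u)) (divDiff-inv w r₂ rs (e₂ ∷ es) (n₂ ∷ ns) (r₂∉ ∷ u)) ⟩
  inv (r₁ * P) - inv (r₂ * P)
    ≡⟨ cong₂ _-_ (inv-* r₁ P) (inv-* r₂ P) ⟩
  inv r₁ * inv P - inv r₂ * inv P
    ≡⟨ lem₁ (inv r₁) (inv r₂) (inv P) ⟩
  1ℚ * (inv r₁ * inv P) - 1ℚ * (inv r₂ * inv P)
    -- Each 1 is expanded as r₂/r₂ or r₁/r₁ to reach the common denominator r₁ r₂ P.
    ≡⟨ cong₂ (λ a b → a * (inv r₁ * inv P) - b * (inv r₂ * inv P)) (inv-inverseʳ n₂) (inv-inverseʳ n₁) ⟨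
  r₂ * inv r₂ * (inv r₁ * inv P) - r₁ * inv r₁ * (inv r₂ * inv P)
    ≡⟨ lem₂ r₁ r₂ (inv r₁) (inv r₂) (inv P) ⟩
  (r₂ - r₁) * (inv r₁ * (inv r₂ * inv P))
    ≡⟨ cong (λ z → (r₂ - r₁) * (inv r₁ * z)) (inv-* r₂ P) ⟨
  (r₂ - r₁) * (inv r₁ * inv (r₂ * P))
    ≡⟨ cong ((r₂ - r₁) *_) (inv-* r₁ (r₂ * P)) ⟨
  (r₂ - r₁) * inv (r₁ * (r₂ * P)) ∎)
  where
  open ≡-Reasoning
  P = prodℚ rs
  lem₁ : ∀ a b p → a * p - b * p ≡ 1ℚ * (a * p) - 1ℚ * (b * p)
  lem₁ = solve-∀ ℚ-ring
  lem₂ : ∀ r₁ r₂ a b p → r₂ * b * (a * p) - r₁ * a * (b * p) ≡ (r₂ - r₁) * (a * (b * p))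
  lem₂ = solve-∀ ℚ-ring

kernel : List ℕ → ℚ → ℚ
kernel ss x = inv x * prodℚ (map (λ s → inv (toℚ s + x)) ss)

-- The asymptotic ratio of `∏ is * excess rs ss is` to the count with all parts 1. It is independent
-- of I; the products over R and S turn it into the limit.
density : List ℕ → List ℕ → ℚ
density rs ss = divDiff (kernel ss) (map toℚ rs)

toℚ-≢ : ∀ {m n} → m ≢ n → toℚ m ≢ toℚ n
toℚ-≢ m≢n eq = m≢n (toℚ-injective eq)

toℚ-≢0 : ∀ {n} → 0 < n → toℚ n ≢ 0ℚ
toℚ-≢0 0<n = 0<⇒≢0 (0<toℚ 0<n)

density-[] : ∀ r rs → Positive (r ∷ rs) → Unique (r ∷ rs) → density (r ∷ rs) [] ≡ inv (∏ (r ∷ rs))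
density-[] r rs pos uniq = divDiff-inv (kernel []) (toℚ r) (map toℚ rs)
  (All.universal (λ x → ℚP.*-identityʳ (inv x)) _)
  (AllP.map⁺ (All.map toℚ-≢0 pos)) (UniqueP.map⁺ toℚ-injective uniq)

-- (s + r) / ((s + x)(r - x)) = 1 / (s + x) + 1 / (r - x).
density-pair : ∀ r rs s ss → 0 < r → Positive rs → 0 < s → All (r ≢_) rs →
  toℚ (r ℕ.+ s) * density (r ∷ rs) (s ∷ ss) ≡ density (r ∷ rs) ss + density rs (s ∷ ss)
density-pair r rs s ss pr prs ps r∉ = begin
  toℚ (r ℕ.+ s) * (k′ ρ * P + D′)
    ≡⟨ cong (_* (k′ ρ * P + D′)) (toℚ-+ r s) ⟩
  (ρ + σ) * (inv ρ * (inv (σ + ρ) * π ρ) * P + D′)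
    ≡⟨ lem ρ σ (inv ρ) (inv (σ + ρ)) (π ρ) P D′ ⟩
  (σ + ρ) * inv (σ + ρ) * (inv ρ * π ρ * P) + (ρ + σ) * D′
    -- At the node r the factor s + r simply cancels: r is not a node of `density rs (s ∷ ss)`, so
    -- it feeds the first term alone.
    ≡⟨ cong₂ (λ a b → a * (inv ρ * π ρ * P) + b) (inv-inverseʳ (σ+≢0 pr)) D-eq ⟩
  1ℚ * (k ρ * P) + (1ℚ * D + 1ℚ * density rs (s ∷ ss))
    ≡⟨ lem₂ (k ρ * P) D (density rs (s ∷ ss)) ⟩
  (k ρ * P + D) + density rs (s ∷ ss) ∎
  where
  open ≡-Reasoning
  ρ = toℚ r
  σ = toℚ s
  k = kernel ss
  k′ = kernel (s ∷ ss)
  qs = map toℚ rs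
  π : ℚ → ℚ
  π x = prodℚ (map (λ s → inv (toℚ s + x)) ss)
  P = prodℚ (map (λ x → inv (x - ρ)) qs)
  D = divDiff (λ x → k x * inv (ρ - x)) qs
  D′ = divDiff (λ x → k′ x * inv (ρ - x)) qs
  σ+≢0 : ∀ {n} → 0 < n → σ + toℚ n ≢ 0ℚ
  σ+≢0 {n} _ = subst (_≢ 0ℚ) (toℚ-+ s n) (toℚ-≢0 (ℕP.<-≤-trans ps (ℕP.m≤m+n s n)))
  lem : ∀ r s i j p q d → (r + s) * (i * (j * p) * q + d) ≡ (s + r) * j * (i * p * q) + (r + s) * d
  lem = solve-∀ ℚ-ring
  lem₂ : ∀ a b c → 1ℚ * a + (1ℚ * b + 1ℚ * c) ≡ (a + b) + c
  lem₂ = solve-∀ ℚ-ring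
  lem₃ : ∀ r s x i a p b → (r + s) * (i * (a * p) * b) ≡ (s + x) * a * (i * p * b) + (r - x) * b * (i * (a * p))
  lem₃ = solve-∀ ℚ-ring
  pointwise : ∀ {n} → 0 < n → r ≢ n →
    (ρ + σ) * (k′ (toℚ n) * inv (ρ - toℚ n)) ≡ 1ℚ * (k (toℚ n) * inv (ρ - toℚ n)) + 1ℚ * k′ (toℚ n)
  pointwise {n} pn r≢n = begin
    (ρ + σ) * (inv x * (inv (σ + x) * π x) * inv (ρ - x))
      ≡⟨ lem₃ ρ σ x (inv x) (inv (σ + x)) (π x) (inv (ρ - x)) ⟩
    (σ + x) * inv (σ + x) * (k x * inv (ρ - x)) + (ρ - x) * inv (ρ - x) * k′ x
      ≡⟨ cong₂ (λ a b → a * (k x * inv (ρ - x)) + b * k′ x)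
           (inv-inverseʳ (σ+≢0 pn)) (inv-inverseʳ (x≢y⇒x-y≢0 (toℚ-≢ r≢n))) ⟩
    1ℚ * (k x * inv (ρ - x)) + 1ℚ * k′ x ∎
    where x = toℚ n
  D-eq : (ρ + σ) * D′ ≡ 1ℚ * D + 1ℚ * density rs (s ∷ ss)
  D-eq = begin
    (ρ + σ) * D′
      ≡⟨ divDiff-* (ρ + σ) (λ x → k′ x * inv (ρ - x)) qs ⟨
    divDiff (λ x → (ρ + σ) * (k′ x * inv (ρ - x))) qs
      ≡⟨ divDiff-cong (AllP.map⁺ (All.zipWith (λ (a , b) → pointwise a b) (prs , r∉))) ⟩
    divDiff (λ x → 1ℚ * (k x * inv (ρ - x)) + 1ℚ * k′ x) qs
      ≡⟨ divDiff-linear 1ℚ 1ℚ _ _ qs ⟩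
    1ℚ * D + 1ℚ * density rs (s ∷ ss) ∎

-- The balance between R and S

1[_>0] : ℤ → ℚ
1[ + zero >0]    = 0ℚ
1[ + (suc _) >0] = 1ℚ
1[ -[1+ _ ] >0]  = 0ℚ

-- The balance is tested once, when the size is used up: `F δ⁺ xs d n` counts the choices of total
-- size `n` for which `d` plus their balance is positive.
δ⁺ : Family
δ⁺ d zero    = 1[ d >0]
δ⁺ _ (suc _) = 0ℚ

δ⁺-nonneg : ∀ d n → 0ℚ Q.≤ δ⁺ d n
δ⁺-nonneg (+ zero)   zero    = ℚP.≤-refl
δ⁺-nonneg (+ suc d)  zero    = 0≤toℚ 1
δ⁺-nonneg (-[1+ d ]) zero    = ℚP.≤-refl
δ⁺-nonneg d          (suc n) = ℚP.≤-refl

δ⁺≤δ : ∀ d n → δ⁺ d n Q.≤ δ d n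
δ⁺≤δ (+ zero)   zero    = 0≤toℚ 1
δ⁺≤δ (+ suc d)  zero    = ℚP.≤-refl
δ⁺≤δ (-[1+ d ]) zero    = 0≤toℚ 1
δ⁺≤δ d          (suc n) = ℚP.≤-refl

-- Dropping the condition on the balance only enlarges the count.
F-δ⁺-Small : ∀ {xs k} → All Pos xs → length xs ≡ k → ∀ d → Small k (F δ⁺ xs d)
F-δ⁺-Small {xs} pxs len d = Small-≤ (F-nonneg δ⁺-nonneg xs d)
  (λ n → subst (F δ⁺ xs d n Q.≤_) (F-δ pxs d n) (F-mono δ⁺≤δ xs d n))
  (count-Small (AllP.map⁺ pxs) (trans (length-map proj₁ xs) len))

iterate-nonpos : ∀ b {x g} → proj₂ x ℤ.≤ + 0 → (∀ d n → d ℤ.≤ + 0 → g d n ≡ 0ℚ) →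
  ∀ d n → d ℤ.≤ + 0 → iterate b x g d n ≡ 0ℚ
iterate-nonpos zero    t≤0 g≡0 d n d≤0 = g≡0 d n d≤0
iterate-nonpos (suc b) {x@(a , t)} {g} t≤0 g≡0 d n d≤0 = begin
  g d n + shift a (iterate b x g (d ℤ.+ t)) n
    ≡⟨ cong₂ _+_ (g≡0 d n d≤0) (shift-cong a n λ m → iterate-nonpos b t≤0 g≡0 (d ℤ.+ t) m (ℤP.+-mono-≤ d≤0 t≤0)) ⟩
  0ℚ + shift a (λ _ → 0ℚ) n
    ≡⟨ cong (_+_ 0ℚ) (shift-0 a n) ⟩
  0ℚ ∎
  where open ≡-Reasoning

-- A nonpositive balance cannot recover if no part raises it. This settles empty R.
F-nonpos : ∀ {xs} → All (λ x → proj₂ x ℤ.≤ + 0) xs → ∀ d n → d ℤ.≤ + 0 → F δ⁺ xs d n ≡ 0ℚ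
F-nonpos []         (+ zero)   zero    _ = refl
F-nonpos []         (-[1+ d ]) zero    _ = refl
F-nonpos []         (+ suc d)  zero    (ℤ.+≤+ ())
F-nonpos []         d          (suc n) _ = refl
F-nonpos (t≤0 ∷ ts) d          n       d≤0 = iterate-nonpos n t≤0 (F-nonpos ts) d n d≤0

iterate-pos : ∀ b {x g h} → + 0 ℤ.≤ proj₂ x → (∀ d n → + 0 ℤ.< d → g d n ≡ h d n) →
  ∀ d n → + 0 ℤ.< d → iterate b x g d n ≡ iterate b x h d n
iterate-pos zero    0≤t g≡h d n 0<d = g≡h d n 0<d
iterate-pos (suc b) {x@(a , t)} 0≤t g≡h d n 0<d = cong₂ _+_ (g≡h d n 0<d)
  (shift-cong a n λ m → iterate-pos b 0≤t g≡h (d ℤ.+ t) m (ℤP.+-mono-<-≤ 0<d 0≤t))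

-- A positive balance is never lost if no part lowers it, so every choice passes the test. This
-- serves empty S.
F-pos : ∀ {xs} → All (λ x → + 0 ℤ.≤ proj₂ x) xs → ∀ d n → + 0 ℤ.< d → F δ⁺ xs d n ≡ F δ xs d n
F-pos []         (+ zero)   zero    (ℤ.+<+ ())
F-pos []         (+ suc d)  zero    _ = refl
F-pos []         (-[1+ d ]) zero    ()
F-pos []         d          (suc n) _ = refl
F-pos (0≤t ∷ ts) d          n       0<d = iterate-pos n 0≤t (F-pos ts) d n 0<d

R-part S-part : ℕ → Part
R-part r = r , + 1
S-part s = s , -[1+ 0 ]

tagged : List ℕ → List ℕ → List ℕ → List Part
tagged rs ss is = map R-part rs ++ map S-part ss ++ map neutral is

excess : List ℕ → List ℕ → List ℕ → ℕ → ℚ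
excess rs ss is = F δ⁺ (tagged rs ss is) (+ 0)

tagged-All : ∀ {P : Part → Set} {rs ss is} → All (λ r → P (R-part r)) rs → All (λ s → P (S-part s)) ss →
  All (λ i → P (neutral i)) is → All P (tagged rs ss is)
tagged-All prs pss pis = AllP.++⁺ (AllP.map⁺ prs) (AllP.++⁺ (AllP.map⁺ pss) (AllP.map⁺ pis))

map-proj₁ : (f : ℕ → ℤ) → ∀ as → map proj₁ (map (λ a → a , f a) as) ≡ as
map-proj₁ f []       = refl
map-proj₁ f (a ∷ as) = cong (a ∷_) (map-proj₁ f as)

sizes-tagged : ∀ rs ss is → map proj₁ (tagged rs ss is) ≡ rs ++ ss ++ is
sizes-tagged rs ss is = begin
  map proj₁ (map R-part rs ++ map S-part ss ++ map neutral is)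
    ≡⟨ map-++ proj₁ (map R-part rs) _ ⟩
  map proj₁ (map R-part rs) ++ map proj₁ (map S-part ss ++ map neutral is)
    ≡⟨ cong₂ _++_ (map-proj₁ _ rs) (map-++ proj₁ (map S-part ss) _) ⟩
  rs ++ map proj₁ (map S-part ss) ++ map proj₁ (map neutral is)
    ≡⟨ cong (rs ++_) (cong₂ _++_ (map-proj₁ _ ss) (map-proj₁ _ is)) ⟩
  rs ++ ss ++ is ∎
  where open ≡-Reasoning

length-tagged : ∀ rs ss is → length (tagged rs ss is) ≡ length (rs ++ ss ++ is)
length-tagged rs ss is =
  trans (sym (length-map proj₁ (tagged rs ss is))) (cong length (sizes-tagged rs ss is))

insert-third : ∀ {A : Set} z (xs ys zs : List A) → xs ++ ys ++ z ∷ zs ↭ z ∷ xs ++ ys ++ zs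
insert-third z xs ys zs = Perm.trans (PermP.++⁺ˡ xs (PermP.shift z ys zs)) (PermP.shift z xs (ys ++ zs))

-- The tags +1 and -1 cancel, so the merged part is neutral and joins I. The rest is `T-pair` for
-- the seed `δ⁺`, with parts moved to and from the front.
excess-pair : ∀ r rs s ss is → Positive (r ∷ rs) → Positive (s ∷ ss) → Positive is → ∀ n →
  excess (r ∷ rs) (s ∷ ss) is n ≡ excess (r ∷ rs) ss (r ℕ.+ s ∷ is) n
    + (excess rs (s ∷ ss) (r ℕ.+ s ∷ is) n - excess rs ss (r ℕ.+ s ∷ is) n)
excess-pair r rs s ss is (pr ∷ prs) (ps ∷ pss) pis n = begin
  F δ⁺ (x ∷ xs ++ y ∷ ys ++ zs) (+ 0) n
    ≡⟨ F-↭ δ⁺ (tagged-All (pr ∷ prs) (ps ∷ pss) pis) (Perm.prep x (PermP.shift y xs (ys ++ zs))) (+ 0) n ⟩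
  T x (T y g) (+ 0) n
    ≡⟨ T-pair pr ps g (+ 0) n ⟩
  T z (T x g) (+ 0) n + (T z (T y g) (+ 0) n - T z g (+ 0) n)
    ≡⟨ cong₂ _+_ (F-↭ δ⁺ (tagged-All (pr ∷ prs) pss (pz ∷ pis)) (insert-third z (x ∷ xs) ys zs) (+ 0) n)
         (cong₂ _-_ (F-↭ δ⁺ (tagged-All prs (ps ∷ pss) (pz ∷ pis))
                       (Perm.trans (insert-third z xs (y ∷ ys) zs) (Perm.prep z (PermP.shift y xs (ys ++ zs)))) (+ 0) n)
                     (F-↭ δ⁺ (tagged-All prs pss (pz ∷ pis)) (insert-third z xs ys zs) (+ 0) n)) ⟨
  excess (r ∷ rs) ss (r ℕ.+ s ∷ is) n + (excess rs (s ∷ ss) (r ℕ.+ s ∷ is) n - excess rs ss (r ℕ.+ s ∷ is) n) ∎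
  where
  open ≡-Reasoning
  x = R-part r
  y = S-part s
  z = neutral (r ℕ.+ s)
  xs = map R-part rs
  ys = map S-part ss
  zs = map neutral is
  g = F δ⁺ (xs ++ ys ++ zs)
  pz : 0 < r ℕ.+ s
  pz = ℕP.<-≤-trans pr (ℕP.m≤m+n r s)

Coprime-pairˡ : ∀ r rs s ss is → Coprime ((r ∷ rs) ++ (s ∷ ss) ++ is) → Coprime ((r ∷ rs) ++ ss ++ (r ℕ.+ s ∷ is))
Coprime-pairˡ r rs s ss is cop d (d∣r ∷ d∣) with AllP.++⁻ rs d∣
... | d∣rs , d∣′ with AllP.++⁻ ss d∣′
...   | d∣ss , d∣r+s ∷ d∣is = cop d (d∣r ∷ AllP.++⁺ d∣rs (∣m+n∣m⇒∣n d∣r+s d∣r ∷ AllP.++⁺ d∣ss d∣is))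

Coprime-pairʳ : ∀ r rs s ss is → Coprime ((r ∷ rs) ++ (s ∷ ss) ++ is) → Coprime (rs ++ (s ∷ ss) ++ (r ℕ.+ s ∷ is))
Coprime-pairʳ r rs s ss is cop d d∣ with AllP.++⁻ rs d∣
... | d∣rs , d∣s ∷ d∣′ with AllP.++⁻ ss d∣′
...   | d∣ss , d∣r+s ∷ d∣is =
  cop d (∣m+n∣m⇒∣n (subst (d ∣_) (ℕP.+-comm r s) d∣r+s) d∣s ∷ AllP.++⁺ d∣rs (d∣s ∷ AllP.++⁺ d∣ss d∣is))

∏-++ : ∀ as bs → ∏ (as ++ bs) ≡ ∏ as * ∏ bs
∏-++ []       bs = sym (ℚP.*-identityˡ (∏ bs))
∏-++ (a ∷ as) bs = trans (cong (toℚ a *_) (∏-++ as bs)) (sym (ℚP.*-assoc (toℚ a) (∏ as) (∏ bs)))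

∏-pos : ∀ {as} → Positive as → 0ℚ Q.< ∏ as
∏-pos []         = 0<toℚ {1} (s≤s z≤n)
∏-pos (pa ∷ pas) = 0<p*q (0<toℚ pa) (∏-pos pas)

-- A partition with at least one part in R has positive excess; those with none are negligible.
excess-[] : ∀ r rs is {k} → Positive (r ∷ rs) → Positive is → length (rs ++ is) ≡ k →
  excess (r ∷ rs) [] is ≈[ k ] count (r ∷ rs ++ is)
excess-[] r rs is {k} (pr ∷ prs) pis len = asymp (Small-cong (λ n → sym (eq n))
  (Small-- (F-δ⁺-Small pxs (trans (length-tagged rs [] is) len) (+ 0)) (count-Small (AllP.++⁺ prs pis) len)))
  where
  open ≡-Reasoning
  xs = tagged rs [] is
  pxs : All Pos xs
  pxs = tagged-All {ss = []} prs [] pis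
  as = rs ++ is
  -- After one copy of `r` the balance is 1 and no remaining part lowers it, so every completion
  -- counts.
  above : ∀ n → F δ⁺ (R-part r ∷ xs) (+ 1) n ≡ count (r ∷ as) n
  above n = begin
    F δ⁺ (R-part r ∷ xs) (+ 1) n
      ≡⟨ F-pos (tagged-All {rs = r ∷ rs} {ss = []} (All.universal (λ _ → ℤ.+≤+ z≤n) _) [] (All.universal (λ _ → ℤ.+≤+ z≤n) is)) (+ 1) n (ℤ.+<+ (s≤s z≤n)) ⟩
    F δ (R-part r ∷ xs) (+ 1) n
      ≡⟨ F-δ (pr ∷ pxs) (+ 1) n ⟩
    count (r ∷ map proj₁ xs) n
      ≡⟨ cong (λ l → count (r ∷ l) n) (sizes-tagged rs [] is) ⟩
    count (r ∷ as) n ∎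
  lem : ∀ e c s → (e + s) - (c + s) ≡ e - c
  lem = solve-∀ ℚ-ring
  eq : ∀ n → excess (r ∷ rs) [] is n - count (r ∷ as) n ≡ F δ⁺ xs (+ 0) n - count as n
  eq n = begin
    excess (r ∷ rs) [] is n - count (r ∷ as) n
      ≡⟨ cong₂ _-_ (T-step pr (F δ⁺ xs) (+ 0) n) (count-step pr as n) ⟩
    (F δ⁺ xs (+ 0) n + shift r (F δ⁺ (R-part r ∷ xs) (+ 1)) n) - (count as n + shift r (count (r ∷ as)) n)
      ≡⟨ cong (λ z → (F δ⁺ xs (+ 0) n + z) - (count as n + shift r (count (r ∷ as)) n)) (shift-cong r n above) ⟩
    (F δ⁺ xs (+ 0) n + shift r (count (r ∷ as)) n) - (count as n + shift r (count (r ∷ as)) n)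
      ≡⟨ lem (F δ⁺ xs (+ 0) n) (count as n) (shift r (count (r ∷ as)) n) ⟩
    F δ⁺ xs (+ 0) n - count as n ∎

length-insert-third : ∀ (rs ss is : List ℕ) i → length (rs ++ ss ++ i ∷ is) ≡ suc (length (rs ++ ss ++ is))
length-insert-third rs ss is i = PermP.↭-length (insert-third i rs ss is)

-- Moving r + s into I multiplies `∏ is` by r + s, the very factor in `density-pair`; this is why
-- the statement is scaled by `∏ is`. Both recursive calls keep the number of parts, so the
-- comparison function stays the same.
excess-≈ : ∀ rs ss is {k} → Positive rs → Positive ss → Positive is → Unique rs →
  Coprime (rs ++ ss ++ is) → length (rs ++ ss ++ is) ≡ suc k →
  (λ n → ∏ is * excess rs ss is n) ≈[ k ] (λ n → density rs ss * count (ones (suc k)) n)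
excess-≈ [] ss is {k} prs pss pis uniq cop len = ≈-cong (λ n → sym (lhs n)) (λ n → sym (ℚP.*-zeroˡ (count (ones (suc k)) n))) ≈-refl
  where
  lhs : ∀ n → ∏ is * excess [] ss is n ≡ 0ℚ
  lhs n = trans (cong (∏ is *_) (F-nonpos {tagged [] ss is} (tagged-All {rs = []} [] (All.universal (λ _ → ℤ.-≤+) ss)
    (All.universal (λ _ → ℤP.≤-refl) is)) (+ 0) n ℤP.≤-refl)) (ℚP.*-zeroʳ (∏ is))
excess-≈ (r ∷ rs) [] is {k} prs pss pis uniq cop len = ≈-trans
  (≈-* (∏ is) (excess-[] r rs is prs pis (ℕP.suc-injective len)))
  (≈-cong (λ n → lhs n) (λ n → cong (_* count (ones (suc k)) n) (sym (density-[] r rs prs uniq)))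
    (≈-* (inv (∏ (r ∷ rs))) (count-≈-ones (r ∷ rs ++ is) 0 (AllP.++⁺ prs pis) cop len)))
  where
  open ≡-Reasoning
  lem : ∀ i a b c → i * (a * b * c) ≡ a * i * (b * c)
  lem = solve-∀ ℚ-ring
  lhs : ∀ n → inv (∏ (r ∷ rs)) * (∏ (r ∷ rs ++ is) * count (r ∷ rs ++ is) n) ≡ ∏ is * count (r ∷ rs ++ is) n
  lhs n = begin
    inv (∏ (r ∷ rs)) * (∏ (r ∷ rs ++ is) * c)
      ≡⟨ cong (λ z → inv (∏ (r ∷ rs)) * (z * c)) (∏-++ (r ∷ rs) is) ⟩
    inv (∏ (r ∷ rs)) * (∏ (r ∷ rs) * ∏ is * c)
      ≡⟨ lem (inv (∏ (r ∷ rs))) (∏ (r ∷ rs)) (∏ is) c ⟩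
    ∏ (r ∷ rs) * inv (∏ (r ∷ rs)) * (∏ is * c)
      ≡⟨ cong (_* (∏ is * c)) (inv-inverseʳ (0<⇒≢0 (∏-pos prs))) ⟩
    1ℚ * (∏ is * c)
      ≡⟨ ℚP.*-identityˡ (∏ is * c) ⟩
    ∏ is * c ∎
    where c = count (r ∷ rs ++ is) n
excess-≈ (r ∷ rs) (s ∷ ss) is {k} (pr ∷ prs) (ps ∷ pss) pis (r∉ ∷ uniq) cop len = ≈-cong lhs rhs
  -- `q` is 1/(r + s); it removes the factor that r + s adds to `∏ is` in both induction hypotheses.
  (≈-+ (≈-* q (≈-+
    (excess-≈ (r ∷ rs) ss (r ℕ.+ s ∷ is) (pr ∷ prs) pss (pz ∷ pis) (r∉ ∷ uniq) (Coprime-pairˡ r rs s ss is cop) len₁)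
    (excess-≈ rs (s ∷ ss) (r ℕ.+ s ∷ is) prs (ps ∷ pss) (pz ∷ pis) uniq (Coprime-pairʳ r rs s ss is cop) len₂)))
    -- The term without `r` and `s` has one part fewer and is compared with 0.
    (asymp third-small))
  where
  open ≡-Reasoning
  t = toℚ (r ℕ.+ s)
  q = inv t
  B = count (ones (suc k))
  e₁ = excess (r ∷ rs) ss (r ℕ.+ s ∷ is)
  e₂ = excess rs (s ∷ ss) (r ℕ.+ s ∷ is)
  e₃ = excess rs ss (r ℕ.+ s ∷ is)
  pz : 0 < r ℕ.+ s
  pz = ℕP.<-≤-trans pr (ℕP.m≤m+n r s)
  len₀ : length (rs ++ ss ++ is) ℕ.+ 1 ≡ k
  len₀ = trans (ℕP.+-comm (length (rs ++ ss ++ is)) 1)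
    (ℕP.suc-injective (trans (cong suc (sym (PermP.↭-length (PermP.shift s rs (ss ++ is))))) len))
  len₃ : length (rs ++ ss ++ r ℕ.+ s ∷ is) ≡ k
  len₃ = trans (length-insert-third rs ss is (r ℕ.+ s)) (trans (ℕP.+-comm 1 _) len₀)
  len₁ : length ((r ∷ rs) ++ ss ++ r ℕ.+ s ∷ is) ≡ suc k
  len₁ = cong suc len₃
  len₂ : length (rs ++ (s ∷ ss) ++ r ℕ.+ s ∷ is) ≡ suc k
  len₂ = trans (PermP.↭-length (PermP.shift s rs (ss ++ r ℕ.+ s ∷ is))) len₁
  third-small : Small k (λ n → (- ∏ is) * e₃ n - 0ℚ)
  third-small = Small-cong (λ n → sym (ℚP.+-identityʳ _)) (Small-* (- ∏ is)
    (F-δ⁺-Small (tagged-All prs pss (pz ∷ pis)) (trans (length-tagged rs ss _) len₃) (+ 0)))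
  lem₁ : ∀ q t p a b c → q * (t * p * a + t * p * b) + - p * c ≡ t * q * (p * (a + b)) - p * c
  lem₁ = solve-∀ ℚ-ring
  lem₂ : ∀ p a b c → 1ℚ * (p * (a + b)) - p * c ≡ p * (a + (b - c))
  lem₂ = solve-∀ ℚ-ring
  lhs : ∀ n → q * (∏ (r ℕ.+ s ∷ is) * e₁ n + ∏ (r ℕ.+ s ∷ is) * e₂ n) + (- ∏ is) * e₃ n
            ≡ ∏ is * excess (r ∷ rs) (s ∷ ss) is n
  lhs n = begin
    q * (t * ∏ is * e₁ n + t * ∏ is * e₂ n) + (- ∏ is) * e₃ n
      ≡⟨ lem₁ q t (∏ is) (e₁ n) (e₂ n) (e₃ n) ⟩
    t * q * (∏ is * (e₁ n + e₂ n)) - ∏ is * e₃ n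
      ≡⟨ cong (λ z → z * (∏ is * (e₁ n + e₂ n)) - ∏ is * e₃ n) (inv-inverseʳ (toℚ-≢0 pz)) ⟩
    1ℚ * (∏ is * (e₁ n + e₂ n)) - ∏ is * e₃ n
      ≡⟨ lem₂ (∏ is) (e₁ n) (e₂ n) (e₃ n) ⟩
    ∏ is * (e₁ n + (e₂ n - e₃ n))
      ≡⟨ cong (∏ is *_) (excess-pair r rs s ss is (pr ∷ prs) (ps ∷ pss) pis n) ⟨
    ∏ is * excess (r ∷ rs) (s ∷ ss) is n ∎
  lem₃ : ∀ q x y b → q * (x * b + y * b) + 0ℚ ≡ q * (x + y) * b
  lem₃ = solve-∀ ℚ-ring
  lem₄ : ∀ q t d b → q * (t * d) * b ≡ t * q * (d * b)
  lem₄ = solve-∀ ℚ-ring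
  D = density (r ∷ rs) (s ∷ ss)
  rhs : ∀ n → q * (density (r ∷ rs) ss * B n + density rs (s ∷ ss) * B n) + 0ℚ ≡ D * B n
  rhs n = begin
    q * (density (r ∷ rs) ss * B n + density rs (s ∷ ss) * B n) + 0ℚ
      ≡⟨ lem₃ q (density (r ∷ rs) ss) (density rs (s ∷ ss)) (B n) ⟩
    q * (density (r ∷ rs) ss + density rs (s ∷ ss)) * B n
      ≡⟨ cong (λ z → q * z * B n) (density-pair r rs s ss pr prs ps r∉) ⟨
    q * (t * D) * B n
      ≡⟨ lem₄ q t D (B n) ⟩
    t * q * (D * B n)
      ≡⟨ cong (_* (D * B n)) (inv-inverseʳ (toℚ-≢0 pz)) ⟩
    1ℚ * (D * B n)
      ≡⟨ ℚP.*-identityˡ (D * B n) ⟩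
    D * B n ∎

-- The limit

-- A discrete mean value bound for x^(k+1) between j and j + 1.
power-increment : ∀ k j → suc j ℕ.^ suc k ≤ j ℕ.^ suc k ℕ.+ suc k ℕ.* suc j ℕ.^ k
power-increment zero j = ℕP.≤-reflexive (begin
  suc j ℕ.* 1            ≡⟨ ℕP.*-identityʳ (suc j) ⟩
  suc j                  ≡⟨ ℕP.+-comm 1 j ⟩
  j ℕ.+ 1                ≡⟨ cong (ℕ._+ 1) (ℕP.*-identityʳ j) ⟨
  j ℕ.* 1 ℕ.+ 1 ℕ.* 1    ∎)
  where open ≡-Reasoning
power-increment (suc k) j = begin
  y ℕ.+ j ℕ.* y
    ≤⟨ ℕP.+-monoʳ-≤ y (ℕP.*-monoʳ-≤ j (power-increment k j)) ⟩
  y ℕ.+ j ℕ.* (j ℕ.^ suc k ℕ.+ suc k ℕ.* x)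
    ≡⟨ cong (y ℕ.+_) (ℕP.*-distribˡ-+ j (j ℕ.^ suc k) (suc k ℕ.* x)) ⟩
  y ℕ.+ (j ℕ.^ suc (suc k) ℕ.+ j ℕ.* (suc k ℕ.* x))
    ≤⟨ ℕP.+-monoʳ-≤ y (ℕP.+-monoʳ-≤ (j ℕ.^ suc (suc k)) j*[1+k]*x≤) ⟩
  y ℕ.+ (j ℕ.^ suc (suc k) ℕ.+ suc k ℕ.* y)
    ≡⟨ ℕP.+-assoc y (j ℕ.^ suc (suc k)) (suc k ℕ.* y) ⟨
  y ℕ.+ j ℕ.^ suc (suc k) ℕ.+ suc k ℕ.* y
    ≡⟨ cong (ℕ._+ suc k ℕ.* y) (ℕP.+-comm y (j ℕ.^ suc (suc k))) ⟩
  j ℕ.^ suc (suc k) ℕ.+ y ℕ.+ suc k ℕ.* y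
    ≡⟨ ℕP.+-assoc (j ℕ.^ suc (suc k)) y (suc k ℕ.* y) ⟩
  j ℕ.^ suc (suc k) ℕ.+ suc (suc k) ℕ.* y ∎
  where
  open ℕP.≤-Reasoning
  x = suc j ℕ.^ k
  y = suc j ℕ.^ suc k
  j*[1+k]*x≤ : j ℕ.* (suc k ℕ.* x) ≤ suc k ℕ.* y
  j*[1+k]*x≤ = begin
    j ℕ.* (suc k ℕ.* x)      ≤⟨ ℕP.*-monoˡ-≤ (suc k ℕ.* x) (ℕP.n≤1+n j) ⟩
    suc j ℕ.* (suc k ℕ.* x)  ≡⟨ ℕP.*-assoc (suc j) (suc k) x ⟨
    suc j ℕ.* suc k ℕ.* x    ≡⟨ cong (ℕ._* x) (ℕP.*-comm (suc j) (suc k)) ⟩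
    suc k ℕ.* suc j ℕ.* x    ≡⟨ ℕP.*-assoc (suc k) (suc j) x ⟩
    suc k ℕ.* y              ∎

-- The count is the binomial C(n + k, k), and k! times it is (n + 1)...(n + k). The induction
-- follows Pascal's rule.
power-≤-ones : ∀ k n → power k n Q.≤ toℚ (k !) * count (ones (suc k)) n
power-≤-ones zero n = ℚP.≤-reflexive (sym (trans (ℚP.*-identityˡ (count (1 ∷ []) n)) (all-one n)))
  where
  all-one : ∀ n → count (1 ∷ []) n ≡ 1ℚ
  all-one zero    = refl
  all-one (suc n) = trans (count-above (s≤s z≤n) [] n) (trans (ℚP.+-identityˡ _) (all-one n))
power-≤-ones (suc k) zero = begin
  toℚ (1 ℕ.^ suc k)                               ≡⟨ cong toℚ (ℕP.*-identityˡ (1 ℕ.^ k)) ⟩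
  power k 0                                       ≤⟨ power-≤-ones k 0 ⟩
  toℚ (k !) * count (ones (suc k)) 0              ≤⟨ *-monoʳ (count-nonneg (ones (suc k)) 0) (toℚ-mono-≤ (ℕP.m≤m+n (k !) (k ℕ.* k !))) ⟩
  toℚ (suc k !) * count (ones (suc k)) 0          ≡⟨ cong (toℚ (suc k !) *_) (count-below {1} (s≤s z≤n) (ones (suc k)) {0} (s≤s z≤n)) ⟨
  toℚ (suc k !) * count (ones (suc (suc k))) 0    ∎
  where open ℚP.≤-Reasoning
power-≤-ones (suc k) (suc n) = begin
  toℚ (suc (suc n) ℕ.^ suc k)
    ≤⟨ toℚ-mono-≤ (power-increment k (suc n)) ⟩
  toℚ (suc n ℕ.^ suc k ℕ.+ suc k ℕ.* suc (suc n) ℕ.^ k)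
    ≡⟨ trans (toℚ-+ (suc n ℕ.^ suc k) (suc k ℕ.* suc (suc n) ℕ.^ k)) (cong (_+_ (power (suc k) n)) (toℚ-* (suc k) (suc (suc n) ℕ.^ k))) ⟩
  power (suc k) n + toℚ (suc k) * power k (suc n)
    ≤⟨ ℚP.+-mono-≤ (power-≤-ones (suc k) n) (*-monoˡ (0≤toℚ (suc k)) (power-≤-ones k (suc n))) ⟩
  toℚ (suc k !) * v n + toℚ (suc k) * (toℚ (k !) * w (suc n))
    ≡⟨ cong (_+_ (toℚ (suc k !) * v n)) (trans (sym (ℚP.*-assoc (toℚ (suc k)) (toℚ (k !)) (w (suc n)))) (cong (_* w (suc n)) (sym (toℚ-* (suc k) (k !))))) ⟩
  toℚ (suc k !) * v n + toℚ (suc k !) * w (suc n)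
    ≡⟨ lem (toℚ (suc k !)) (v n) (w (suc n)) ⟩
  toℚ (suc k !) * (w (suc n) + v n)
    ≡⟨ cong (toℚ (suc k !) *_) (count-above (s≤s z≤n) (ones (suc k)) n) ⟨
  toℚ (suc k !) * v (suc n) ∎
  where
  open ℚP.≤-Reasoning
  v = count (ones (suc (suc k)))
  w = count (ones (suc k))
  lem : ∀ a x y → a * x + a * y ≡ a * (y + x)
  lem = solve-∀ ℚ-ring

-- The denominator is at least 1, so it suffices to exceed the numerator.
archimedean : ∀ q → ∃ λ N → q Q.< toℚ N
archimedean q = N , ℚP.toℚᵘ-cancel-< (ℚᵘP.<-respʳ-≃ (ℚᵘP.≃-sym (toℚᵘ-toℚ N)) (ℚᵘ.*<* num<))
  where
  N = suc ℤ.∣ Q.↥ q ∣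
  i≤∣i∣ : ∀ i → i ℤ.≤ + ℤ.∣ i ∣
  i≤∣i∣ (+ n)     = ℤP.≤-refl
  i≤∣i∣ -[1+ n ] = ℤ.-≤+
  num< : ℚᵘ.↥ Q.toℚᵘ q ℤ.* + 1 ℤ.< + N ℤ.* ℚᵘ.↧ Q.toℚᵘ q
  num< = begin-strict
    ℚᵘ.↥ Q.toℚᵘ q ℤ.* + 1          ≡⟨ ℤP.*-identityʳ _ ⟩
    ℚᵘ.↥ Q.toℚᵘ q                  ≡⟨ ℚP.↥ᵘ-toℚᵘ q ⟩
    Q.↥ q                          ≤⟨ i≤∣i∣ (Q.↥ q) ⟩
    + ℤ.∣ Q.↥ q ∣                  <⟨ ℤ.+<+ ℕP.≤-refl ⟩
    + N                            ≤⟨ ℤ.+≤+ (ℕP.m≤m*n N (Q.↧ₙ q)) ⟩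
    + (N ℕ.* Q.↧ₙ q)               ≡⟨ ℤP.pos-* N (Q.↧ₙ q) ⟩
    + N ℤ.* Q.↧ q                  ≡⟨ cong (+ N ℤ.*_) (ℚP.↧ᵘ-toℚᵘ q) ⟨
    + N ℤ.* ℚᵘ.↧ Q.toℚᵘ q          ∎
    where open ℤP.≤-Reasoning

x-∣x-y∣≤y : ∀ x y → x - ∣ y - x ∣ Q.≤ y
x-∣x-y∣≤y x y = begin
  x - ∣ y - x ∣            ≡⟨ lem x y ∣ y - x ∣ ⟩
  y + ((x - y) - ∣ y - x ∣) ≤⟨ ℚP.+-monoʳ-≤ y (ℚP.+-monoˡ-≤ (- ∣ y - x ∣) x-y≤) ⟩
  y + (∣ y - x ∣ - ∣ y - x ∣) ≡⟨ lem₂ y ∣ y - x ∣ ⟩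
  y                        ∎
  where
  open ℚP.≤-Reasoning
  lem : ∀ x y a → x - a ≡ y + ((x - y) - a)
  lem = solve-∀ ℚ-ring
  lem₂ : ∀ y a → y + (a - a) ≡ y
  lem₂ = solve-∀ ℚ-ring
  neg-flip : ∀ x y → - (x - y) ≡ y - x
  neg-flip = solve-∀ ℚ-ring
  p≤∣p∣ : ∀ p → p Q.≤ ∣ p ∣
  p≤∣p∣ p with ℚP.≤-total 0ℚ p
  ... | inj₁ 0≤p = ℚP.≤-reflexive (sym (ℚP.0≤p⇒∣p∣≡p 0≤p))
  ... | inj₂ p≤0 = ℚP.≤-trans p≤0 (ℚP.0≤∣p∣ p)
  x-y≤ : x - y Q.≤ ∣ y - x ∣
  x-y≤ = subst (x - y Q.≤_) (trans (sym (ℚP.∣-p∣≡∣p∣ (x - y))) (cong ∣_∣ (neg-flip x y))) (p≤∣p∣ (x - y))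

-- The error has order n^(k-1) while `c` has order n^k. Multiplying the bound out by `c n` postpones
-- the division, and its strictness forces `c n` to be positive, so that the quotient will exist.
ratio-limit : ∀ {k P L} {e c : ℕ → ℚ} → 0ℚ Q.< P →
  (λ n → P * c n) ≈[ k ] count (ones (suc k)) → e ≈[ k ] (λ n → L * c n) →
  ∀ {ε} → 0ℚ Q.< ε → ∃ λ N → ∀ n → N ≤ n → ∣ e n - L * c n ∣ Q.< ε * c n
ratio-limit {k} {P} {L} {e} {c} 0<P (asymp (small C₁ 0≤C₁ est₁)) (asymp (small C₂ 0≤C₂ est₂)) {ε} 0<ε =
  proj₁ large , bound
  where
  D = toℚ (k !)
  0<D : 0ℚ Q.< D
  0<D = 0<toℚ (ℕP.1≤n! k)
  -- n > M says that ε (n - D C₁) > D P C₂: the first summand of `M` pays for the error in `P * c`,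
  -- the second for the error in `e`.
  M = D * C₁ + D * P * C₂ * inv ε
  large = archimedean M
  bound : ∀ n → proj₁ large ≤ n → ∣ e n - L * c n ∣ Q.< ε * c n
  bound n N≤n = ℚP.*-cancelˡ-<-nonNeg ν {{Q.nonNegative (0≤toℚ n)}} (ℚP.≤-<-trans (est₂ n)
    (ℚP.*-cancelˡ-<-nonNeg (D * P) {{Q.nonNegative (ℚP.<⇒≤ (0<p*q 0<D 0<P))}} (begin-strict
      D * P * (C₂ * W)                              ≡⟨ ℚP.*-identityˡ (D * P * (C₂ * W)) ⟨
      1ℚ * (D * P * (C₂ * W))                       ≡⟨ cong (_* (D * P * (C₂ * W))) (inv-inverseʳ (0<⇒≢0 0<ε)) ⟨
      ε * inv ε * (D * P * (C₂ * W))                ≡⟨ lem₁ ε (inv ε) D P C₂ W C₁ ⟩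
      ε * ((M - D * C₁) * W)                        <⟨ ℚP.*-monoʳ-<-pos ε {{Q.positive 0<ε}} (ℚP.*-monoˡ-<-pos W {{Q.positive 0<W}} (ℚP.+-monoˡ-< (- (D * C₁)) M<ν)) ⟩
      ε * ((ν - D * C₁) * W)                        ≡⟨ cong (ε *_) (lem₂ ν D C₁ W) ⟩
      ε * (ν * W - D * (C₁ * W))                    ≤⟨ *-monoˡ (ℚP.<⇒≤ 0<ε) lower ⟩
      ε * (D * (ν * (P * c n)))                     ≡⟨ lem₃ ε D ν P (c n) ⟩
      D * P * (ν * (ε * c n))                       ∎)))
    where
    open ℚP.≤-Reasoning
    ν = toℚ n
    W = power k n
    B = count (ones (suc k)) n
    0<W : 0ℚ Q.< W
    0<W = 0<toℚ (ℕP.m^n>0 (suc n) k)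
    M<ν : M Q.< ν
    M<ν = ℚP.<-≤-trans (proj₂ large) (toℚ-mono-≤ N≤n)
    lem₁ : ∀ ε ι d p c w c₁ → ε * ι * (d * p * (c * w)) ≡ ε * ((d * c₁ + d * p * c * ι - d * c₁) * w)
    lem₁ = solve-∀ ℚ-ring
    lem₂ : ∀ n d c w → (n - d * c) * w ≡ n * w - d * (c * w)
    lem₂ = solve-∀ ℚ-ring
    lem₃ : ∀ ε d n p c → ε * (d * (n * (p * c))) ≡ d * p * (n * (ε * c))
    lem₃ = solve-∀ ℚ-ring
    lem₄ : ∀ d n b a → n * (d * b) - d * (n * a) ≡ d * (n * (b - a))
    lem₄ = solve-∀ ℚ-ring
    -- A lower bound for `c n`, scaled by n and k!: the ones supply n (n+1)^k, and the error takes
    -- away at most k! C₁ (n+1)^k.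
    lower : ν * W - D * (C₁ * W) Q.≤ D * (ν * (P * c n))
    lower = begin
      ν * W - D * (C₁ * W)
        ≤⟨ ℚP.+-mono-≤ (*-monoˡ (0≤toℚ n) (power-≤-ones k n)) (ℚP.neg-antimono-≤ (*-monoˡ (ℚP.<⇒≤ 0<D) (est₁ n))) ⟩
      ν * (D * B) - D * (ν * ∣ P * c n - B ∣)
        ≡⟨ lem₄ D ν B ∣ P * c n - B ∣ ⟩
      D * (ν * (B - ∣ P * c n - B ∣))
        ≤⟨ *-monoˡ (ℚP.<⇒≤ 0<D) (*-monoˡ (0≤toℚ n) (x-∣x-y∣≤y B (P * c n))) ⟩
      D * (ν * (P * c n)) ∎

-- Up to lower order both functions are multiples of `count (ones (suc k))`. Eliminating it leaves
-- their ratio, from which `∏ is` cancels.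
excess-count-≈ : ∀ rs ss is {k} → Positive rs → Positive ss → Positive is → Unique rs →
  Coprime (rs ++ ss ++ is) → length (rs ++ ss ++ is) ≡ suc k →
  excess rs ss is ≈[ k ] (λ n → ∏ rs * ∏ ss * density rs ss * count (rs ++ ss ++ is) n)
excess-count-≈ rs ss is {k} prs pss pis uniq cop len =
  ≈-cong (λ n → unscale (excess rs ss is n)) rhs (≈-* (inv Πi) (≈-trans
    (excess-≈ rs ss is prs pss pis uniq cop len)
    (≈-* Δ (≈-sym (count-≈-ones (rs ++ ss ++ is) 0 (AllP.++⁺ prs (AllP.++⁺ pss pis)) cop len)))))
  where
  open ≡-Reasoning
  Πi = ∏ is
  Δ = density rs ss
  c = count (rs ++ ss ++ is)
  lem : ∀ i p x → i * (p * x) ≡ p * i * x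
  lem = solve-∀ ℚ-ring
  unscale : ∀ x → inv Πi * (Πi * x) ≡ x
  unscale x = begin
    inv Πi * (Πi * x)   ≡⟨ lem (inv Πi) Πi x ⟩
    Πi * inv Πi * x     ≡⟨ cong (_* x) (inv-inverseʳ (0<⇒≢0 (∏-pos pis))) ⟩
    1ℚ * x              ≡⟨ ℚP.*-identityˡ x ⟩
    x                   ∎
  lem₂ : ∀ d r s i c → d * (r * (s * i) * c) ≡ i * (r * s * d * c)
  lem₂ = solve-∀ ℚ-ring
  rhs : ∀ n → inv Πi * (Δ * (∏ (rs ++ ss ++ is) * c n)) ≡ ∏ rs * ∏ ss * Δ * c n
  rhs n = begin
    inv Πi * (Δ * (∏ (rs ++ ss ++ is) * c n))
      ≡⟨ cong (λ z → inv Πi * (Δ * (z * c n))) (trans (∏-++ rs (ss ++ is)) (cong (∏ rs *_) (∏-++ ss is))) ⟩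
    inv Πi * (Δ * (∏ rs * (∏ ss * Πi) * c n))
      ≡⟨ cong (inv Πi *_) (lem₂ Δ (∏ rs) (∏ ss) Πi (c n)) ⟩
    inv Πi * (Πi * (∏ rs * ∏ ss * Δ * c n))
      ≡⟨ unscale _ ⟩
    ∏ rs * ∏ ss * Δ * c n ∎

-- The stated limit as a divided difference

prodℚ-filter : ∀ {A : Set} {P : A → Set} (P? : Decidable P) (g : A → ℚ) xs →
  prodℚ (map g (filter P? xs)) ≡ prodℚ (map (λ x → if does (P? x) then g x else 1ℚ) xs)
prodℚ-filter P? g []       = refl
prodℚ-filter P? g (x ∷ xs) with does (P? x)
... | true  = cong (g x *_) (prodℚ-filter P? g xs)
... | false = trans (prodℚ-filter P? g xs) (sym (ℚP.*-identityˡ _))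

inv-prodℚ : ∀ {A : Set} (g : A → ℚ) xs → inv (prodℚ (map g xs)) ≡ prodℚ (map (inv ∘ g) xs)
inv-prodℚ g []       = refl
inv-prodℚ g (x ∷ xs) = trans (inv-* (g x) (prodℚ (map g xs))) (cong (inv (g x) *_) (inv-prodℚ g xs))

inv-prodℚ-filter : ∀ {n} {P : Fin n → Set} (P? : Decidable P) (g : Fin n → ℚ) →
  inv (prodℚ (map g (filter P? (allFin n)))) ≡ prodℚ (tabulate (λ j → if does (P? j) then inv (g j) else 1ℚ))
inv-prodℚ-filter {n} P? g = begin
  inv (prodℚ (map g (filter P? (allFin n))))        ≡⟨ inv-prodℚ g (filter P? (allFin n)) ⟩
  prodℚ (map (inv ∘ g) (filter P? (allFin n)))      ≡⟨ prodℚ-filter P? (inv ∘ g) (allFin n) ⟩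
  prodℚ (map (λ j → if does (P? j) then inv (g j) else 1ℚ) (allFin n)) ≡⟨ cong prodℚ (map-tabulate {n = n} id _) ⟩
  prodℚ (tabulate (λ j → if does (P? j) then inv (g j) else 1ℚ)) ∎
  where open ≡-Reasoning

tabulate-lookup : ∀ {A : Set} {n} (v : Vec A n) → tabulate (lookup v) ≡ toList v
tabulate-lookup Vec.[]      = refl
tabulate-lookup (x Vec.∷ v) = cong (x ∷_) (tabulate-lookup v)

map-lookup-allFin : ∀ {A B : Set} {n} (f : A → B) (v : Vec A n) → map (λ i → f (lookup v i)) (allFin n) ≡ map f (toList v)
map-lookup-allFin {n = n} f v = begin
  map (λ i → f (lookup v i)) (allFin n)   ≡⟨ map-tabulate {n = n} id _ ⟩
  tabulate (λ i → f (lookup v i))         ≡⟨ map-tabulate {n = n} (lookup v) f ⟨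
  map f (tabulate (lookup v))             ≡⟨ cong (map f) (tabulate-lookup v) ⟩
  map f (toList v)                        ∎
  where open ≡-Reasoning

-- Indices that a filter would drop contribute a factor 1, so the products unfold along `Fin.suc` by
-- computation.
product-after product-before : ∀ {l} → (Fin l → ℚ) → Fin l → ℚ
product-after  r i = prodℚ (tabulate (λ j → if toℕ i ℕ.<ᵇ toℕ j then inv (r j - r i) else 1ℚ))
product-before r i = prodℚ (tabulate (λ t → if toℕ t ℕ.<ᵇ toℕ i then inv (r i - r t) else 1ℚ))

prodℚ-1 : ∀ n → prodℚ (tabulate {n = n} (λ _ → 1ℚ)) ≡ 1ℚ
prodℚ-1 zero    = refl
prodℚ-1 (suc n) = trans (ℚP.*-identityˡ _) (prodℚ-1 n)

-- The sign (-1)^i turns the i factors inv (r i - r t) with t < i into inv (r t - r i).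
divDiff-sum : ∀ {l} (r : Fin l → ℚ) (w : ℚ → ℚ) →
  sumℚ (tabulate (λ i → sign (toℕ i) * (w (r i) * (product-after r i * product-before r i)))) ≡ divDiff w (tabulate r)
divDiff-sum {zero}  r w = refl
divDiff-sum {suc l} r w = cong₂ _+_ head-eq (trans (cong sumℚ (tabulate-cong {n = l} tail-eq)) (divDiff-sum r′ w′))
  where
  open ≡-Reasoning
  r₀ = r Fin.zero
  r′ : Fin l → ℚ
  r′ i = r (Fin.suc i)
  w′ : ℚ → ℚ
  w′ x = w x * inv (r₀ - x)
  P = prodℚ (tabulate (λ j → inv (r′ j - r₀)))
  lem : ∀ w p → 1ℚ * (w * (1ℚ * p * (1ℚ * 1ℚ))) ≡ w * p
  lem = solve-∀ ℚ-ring
  head-eq : 1ℚ * (w r₀ * (1ℚ * P * (1ℚ * prodℚ (tabulate {n = l} (λ _ → 1ℚ))))) ≡ w r₀ * prodℚ (map (λ x → inv (x - r₀)) (tabulate r′))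
  head-eq = begin
    1ℚ * (w r₀ * (1ℚ * P * (1ℚ * prodℚ (tabulate {n = l} (λ _ → 1ℚ)))))
      ≡⟨ cong (λ z → 1ℚ * (w r₀ * (1ℚ * P * (1ℚ * z)))) (prodℚ-1 l) ⟩
    1ℚ * (w r₀ * (1ℚ * P * (1ℚ * 1ℚ)))
      ≡⟨ lem (w r₀) P ⟩
    w r₀ * P
      ≡⟨ cong (λ z → w r₀ * prodℚ z) (map-tabulate {n = l} r′ (λ x → inv (x - r₀))) ⟨
    w r₀ * prodℚ (map (λ x → inv (x - r₀)) (tabulate r′)) ∎
  lem₂ : ∀ s w a i b → - s * (w * (1ℚ * a * (- i * b))) ≡ s * (w * i * (a * b))
  lem₂ = solve-∀ ℚ-ring
  neg-flip : ∀ x y → x - y ≡ - (y - x)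
  neg-flip = solve-∀ ℚ-ring
  tail-eq : ∀ i → - sign (toℕ i) * (w (r′ i) * (1ℚ * product-after r′ i * (inv (r′ i - r₀) * product-before r′ i)))
                ≡ sign (toℕ i) * (w′ (r′ i) * (product-after r′ i * product-before r′ i))
  tail-eq i = begin
    - sign (toℕ i) * (w (r′ i) * (1ℚ * product-after r′ i * (inv (r′ i - r₀) * product-before r′ i)))
      ≡⟨ cong (λ z → - sign (toℕ i) * (w (r′ i) * (1ℚ * product-after r′ i * (z * product-before r′ i))))
           (trans (cong inv (neg-flip (r′ i) r₀)) (inv-neg (r₀ - r′ i))) ⟩
    - sign (toℕ i) * (w (r′ i) * (1ℚ * product-after r′ i * (- inv (r₀ - r′ i) * product-before r′ i)))
      ≡⟨ lem₂ (sign (toℕ i)) (w (r′ i)) (product-after r′ i) (inv (r₀ - r′ i)) (product-before r′ i) ⟩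
    sign (toℕ i) * (w′ (r′ i) * (product-after r′ i * product-before r′ i)) ∎

limitValue-density : ∀ {l m} (R : Vec ℕ l) (S : Vec ℕ m) →
  limitValue R S ≡ ∏ (toList R) * ∏ (toList S) * density (toList R) (toList S)
limitValue-density {l} {m} R S = cong (∏ (toList R) * ∏ (toList S) *_) (begin
  sumℚ (map term (allFin l))
    ≡⟨ cong sumℚ (map-tabulate {n = l} id term) ⟩
  sumℚ (tabulate term)
    ≡⟨ cong sumℚ (tabulate-cong {n = l} term-eq) ⟩
  sumℚ (tabulate (λ i → sign (toℕ i) * (kernel (toList S) (r i) * (product-after r i * product-before r i))))
    ≡⟨ divDiff-sum r (kernel (toList S)) ⟩
  divDiff (kernel (toList S)) (tabulate r)
    ≡⟨ cong (divDiff (kernel (toList S))) (trans (sym (map-tabulate {n = l} id r)) (map-lookup-allFin toℚ R)) ⟩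
  density (toList R) (toList S) ∎)
  where
  open ≡-Reasoning
  r : Fin l → ℚ
  r i = toℚ (lookup R i)
  lem : ∀ i a b s → i * a * b * s ≡ i * s * (a * b)
  lem = solve-∀ ℚ-ring
  -- These repeat the local definitions of `limitValue` and agree with them by computation.
  A B C term : Fin l → ℚ
  A i = prodℚ (map (λ j → r j - r i) (filter (λ j → toℕ i ℕ.<? toℕ j) (allFin l)))
  B i = prodℚ (map (λ t → r i - r t) (filter (λ t → toℕ t ℕ.<? toℕ i) (allFin l)))
  C i = prodℚ (map (λ k → toℚ (lookup S k) + r i) (allFin m))
  term i = sign (toℕ i) * inv (r i * A i * B i * C i)
  term-eq : ∀ i → term i ≡ sign (toℕ i) * (kernel (toList S) (r i) * (product-after r i * product-before r i))
  term-eq i = cong (sign (toℕ i) *_) (begin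
    inv (r i * A i * B i * C i)
      ≡⟨ inv-* (r i * A i * B i) (C i) ⟩
    inv (r i * A i * B i) * inv (C i)
      ≡⟨ cong (_* inv (C i)) (trans (inv-* (r i * A i) (B i)) (cong (_* inv (B i)) (inv-* (r i) (A i)))) ⟩
    inv (r i) * inv (A i) * inv (B i) * inv (C i)
      ≡⟨ cong₂ (λ a b → inv (r i) * a * b * inv (C i))
           (inv-prodℚ-filter (λ j → toℕ i ℕ.<? toℕ j) (λ j → r j - r i))
           (inv-prodℚ-filter (λ t → toℕ t ℕ.<? toℕ i) (λ t → r i - r t)) ⟩
    inv (r i) * product-after r i * product-before r i * inv (C i)
      ≡⟨ cong (inv (r i) * product-after r i * product-before r i *_)
           (trans (inv-prodℚ _ (allFin m)) (cong prodℚ (map-lookup-allFin (λ s → inv (toℚ s + r i)) S))) ⟩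
    inv (r i) * product-after r i * product-before r i * prodℚ (map (λ s → inv (toℚ s + r i)) (toList S))
      ≡⟨ lem (inv (r i)) (product-after r i) (product-before r i) _ ⟩
    kernel (toList S) (r i) * (product-after r i * product-before r i) ∎)

-- Enumeration of partitions

sumℚ-++ : ∀ xs ys → sumℚ (xs ++ ys) ≡ sumℚ xs + sumℚ ys
sumℚ-++ []       ys = sym (ℚP.+-identityˡ (sumℚ ys))
sumℚ-++ (x ∷ xs) ys = trans (cong (_+_ x) (sumℚ-++ xs ys)) (sym (ℚP.+-assoc x (sumℚ xs) (sumℚ ys)))

sumℚ-concatMap : ∀ {A B : Set} (f : B → ℚ) (h : A → List B) xs →
  sumℚ (map f (concatMap h xs)) ≡ sumℚ (map (λ x → sumℚ (map f (h x))) xs)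
sumℚ-concatMap f h []       = refl
sumℚ-concatMap f h (x ∷ xs) = begin
  sumℚ (map f (h x ++ concatMap h xs))                          ≡⟨ cong sumℚ (map-++ f (h x) (concatMap h xs)) ⟩
  sumℚ (map f (h x) ++ map f (concatMap h xs))                  ≡⟨ sumℚ-++ (map f (h x)) _ ⟩
  sumℚ (map f (h x)) + sumℚ (map f (concatMap h xs))            ≡⟨ cong (_+_ (sumℚ (map f (h x)))) (sumℚ-concatMap f h xs) ⟩
  sumℚ (map f (h x)) + sumℚ (map (λ x → sumℚ (map f (h x))) xs) ∎
  where open ≡-Reasoning

shift-sumℚ : ∀ {A : Set} a (f : A → ℕ → ℚ) xs n →
  shift a (λ m → sumℚ (map (λ x → f x m) xs)) n ≡ sumℚ (map (λ x → shift a (f x) n) xs)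
shift-sumℚ a f []       n = shift-0 a n
shift-sumℚ a f (x ∷ xs) n = trans (shift-add a (f x) _ n) (cong (_+_ (shift a (f x) n)) (shift-sumℚ a f xs n))

sumℚ-upTo-suc : ∀ (f : ℕ → ℚ) b → sumℚ (map f (upTo (suc b))) ≡ f 0 + sumℚ (map (f ∘ suc) (upTo b))
sumℚ-upTo-suc f b = cong (λ l → f 0 + sumℚ l) (trans (map-applyUpTo suc f b) (sym (map-applyUpTo id (f ∘ suc) b)))

-- One summand X^c h for each multiplicity `c`: the term c = 0 is split off, and one X is taken out
-- of the rest.
iterate-sum : ∀ b a t (h : Family) d n →
  sumℚ (map (λ c → shift (a ℕ.* c) (h (d ℤ.+ t ℤ.* + c)) n) (upTo (suc b))) ≡ iterate b (a , t) h d n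
iterate-sum b a t h d n = trans (trans (sumℚ-upTo-suc (λ c → shift (a ℕ.* c) (h (d ℤ.+ t ℤ.* + c)) n) b) (cong₂ _+_ first (cong sumℚ (map-cong step (upTo b))))) (rest b)
  where
  open ≡-Reasoning
  first : shift (a ℕ.* 0) (h (d ℤ.+ t ℤ.* + 0)) n ≡ h d n
  first = cong₂ (λ m e → shift m (h e) n) (ℕP.*-zeroʳ a) (trans (cong (ℤ._+_ d) (ℤP.*-zeroʳ t)) (ℤP.+-identityʳ d))
  step : ∀ c → shift (a ℕ.* suc c) (h (d ℤ.+ t ℤ.* + suc c)) n
             ≡ shift a (λ m → shift (a ℕ.* c) (h (d ℤ.+ t ℤ.+ t ℤ.* + c)) m) n
  step c = begin
    shift (a ℕ.* suc c) (h (d ℤ.+ t ℤ.* + suc c)) n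
      ≡⟨ cong₂ (λ m e → shift m (h e) n) (ℕP.*-suc a c)
           (trans (cong (ℤ._+_ d) (ℤP.*-suc t (+ c))) (sym (ℤP.+-assoc d t (t ℤ.* + c)))) ⟩
    shift (a ℕ.+ a ℕ.* c) (h (d ℤ.+ t ℤ.+ t ℤ.* + c)) n
      ≡⟨ shift-+ a (a ℕ.* c) _ n ⟨
    shift a (λ m → shift (a ℕ.* c) (h (d ℤ.+ t ℤ.+ t ℤ.* + c)) m) n ∎
  rest : ∀ b → h d n + sumℚ (map (λ c → shift a (λ m → shift (a ℕ.* c) (h (d ℤ.+ t ℤ.+ t ℤ.* + c)) m) n) (upTo b))
             ≡ iterate b (a , t) h d n
  rest zero    = ℚP.+-identityʳ (h d n)
  rest (suc b) = cong (_+_ (h d n)) (trans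
    (sym (shift-sumℚ a (λ c → shift (a ℕ.* c) (h (d ℤ.+ t ℤ.+ t ℤ.* + c))) (upTo (suc b)) n))
    (shift-cong a n (iterate-sum b a t h (d ℤ.+ t))))

-- Truncates as the zip in `weight` does, so the identities below hold for vectors of any length.
balance : List Part → List ℕ → ℤ
balance []             cs       = + 0
balance (_ ∷ _)        []       = + 0
balance ((_ , t) ∷ xs) (c ∷ cs) = t ℤ.* + c ℤ.+ balance xs cs

-- `bounded` uses one bound `b` for every multiplicity, while `T` adapts its bound to the size that
-- is left; hence `iterate b` in place of `T`.
enumerate : ∀ g b xs d n → let as = map proj₁ xs in
  sumℚ (map (λ c → shift (weight as c) (g (d ℤ.+ balance xs c)) n) (bounded (length as) b)) ≡ foldr (iterate b) g xs d n
enumerate g b [] d n = trans (ℚP.+-identityʳ _) (cong (λ e → g e n) (ℤP.+-identityʳ d))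
enumerate g b ((a , t) ∷ xs) d n = begin
  sumℚ (map f (concatMap (λ c → map (c ∷_) (bounded (length as) b)) (upTo (suc b))))
    ≡⟨ sumℚ-concatMap f (λ c → map (c ∷_) (bounded (length as) b)) (upTo (suc b)) ⟩
  sumℚ (map (λ c → sumℚ (map f (map (c ∷_) (bounded (length as) b)))) (upTo (suc b)))
    ≡⟨ cong sumℚ (map-cong fibre (upTo (suc b))) ⟩
  sumℚ (map (λ c → shift (a ℕ.* c) (foldr (iterate b) g xs (d ℤ.+ t ℤ.* + c)) n) (upTo (suc b)))
    ≡⟨ iterate-sum b a t (foldr (iterate b) g xs) d n ⟩
  iterate b (a , t) (foldr (iterate b) g xs) d n ∎
  where
  open ≡-Reasoning
  as = map proj₁ xs
  f : List ℕ → ℚ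
  f c = shift (weight (a ∷ as) c) (g (d ℤ.+ balance ((a , t) ∷ xs) c)) n
  fibre : ∀ c → sumℚ (map f (map (c ∷_) (bounded (length as) b)))
              ≡ shift (a ℕ.* c) (foldr (iterate b) g xs (d ℤ.+ t ℤ.* + c)) n
  fibre c = begin
    sumℚ (map f (map (c ∷_) (bounded (length as) b)))
      ≡⟨ cong sumℚ (map-∘ (bounded (length as) b)) ⟨
    sumℚ (map (λ cs → f (c ∷ cs)) (bounded (length as) b))
      ≡⟨ cong sumℚ (map-cong (λ cs → trans
           (cong (λ e → shift (a ℕ.* c ℕ.+ weight as cs) (g e) n) (sym (ℤP.+-assoc d (t ℤ.* + c) (balance xs cs))))
           (sym (shift-+ (a ℕ.* c) (weight as cs) _ n))) (bounded (length as) b)) ⟩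
    sumℚ (map (λ cs → shift (a ℕ.* c) (shift (weight as cs) (g (d ℤ.+ t ℤ.* + c ℤ.+ balance xs cs))) n) (bounded (length as) b))
      ≡⟨ shift-sumℚ (a ℕ.* c) _ (bounded (length as) b) n ⟨
    shift (a ℕ.* c) (λ m → sumℚ (map (λ cs → shift (weight as cs) (g (d ℤ.+ t ℤ.* + c ℤ.+ balance xs cs)) m) (bounded (length as) b))) n
      ≡⟨ shift-cong (a ℕ.* c) n (enumerate g b xs (d ℤ.+ t ℤ.* + c)) ⟩
    shift (a ℕ.* c) (foldr (iterate b) g xs (d ℤ.+ t ℤ.* + c)) n ∎

iterate-cong-≤ : ∀ b x {f g} n → (∀ d m → m ≤ n → f d m ≡ g d m) → ∀ d m → m ≤ n → iterate b x f d m ≡ iterate b x g d m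
iterate-cong-≤ zero    x n f≗g d m m≤n = f≗g d m m≤n
iterate-cong-≤ (suc b) x@(a , t) n f≗g d m m≤n = cong₂ _+_ (f≗g d m m≤n)
  (shift-cong-≤ a m λ j j≤m → iterate-cong-≤ b x n f≗g (d ℤ.+ t) j (ℕP.≤-trans j≤m m≤n))

-- Parts are positive, so any bound that is at least the remaining size already gives the whole
-- geometric series.
foldr-iterate-F : ∀ g {xs} → All Pos xs → ∀ b d m → m ≤ b → foldr (iterate b) g xs d m ≡ F g xs d m
foldr-iterate-F g []                  b d m m≤b = refl
foldr-iterate-F g {x ∷ xs} (px ∷ pxs) b d m m≤b = trans
  (iterate-cong-≤ b x b (foldr-iterate-F g pxs b) d m m≤b)
  (iterate-stable px (F g xs) b m d m m≤b ℕP.≤-refl)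

enumerate-F : ∀ g {xs as} → All Pos xs → map proj₁ xs ≡ as → ∀ n →
  sumℚ (map (λ c → shift (weight as c) (g (+ 0 ℤ.+ balance xs c)) n) (bounded (length as) n)) ≡ F g xs (+ 0) n
enumerate-F g {xs} pxs refl n = trans (enumerate g n xs (+ 0) n) (foldr-iterate-F g pxs n (+ 0) n ℕP.≤-refl)

length-filter : ∀ {A : Set} {P : A → Set} (P? : Decidable P) (f : A → ℚ) →
  (∀ x → P x → f x ≡ 1ℚ) → (∀ x → ¬ P x → f x ≡ 0ℚ) → ∀ xs → toℚ (length (filter P? xs)) ≡ sumℚ (map f xs)
length-filter P? f f≡1 f≡0 [] = refl
length-filter P? f f≡1 f≡0 (x ∷ xs) with P? x
... | yes px = trans (toℚ-suc (length (filter P? xs))) (cong₂ _+_ (sym (f≡1 x px)) (length-filter P? f f≡1 f≡0 xs))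
... | no ¬px = trans (length-filter P? f f≡1 f≡0 xs) (trans (sym (ℚP.+-identityˡ _)) (cong (_+ sumℚ (map f xs)) (sym (f≡0 x ¬px))))

sumℚ-filter : ∀ {A : Set} {P : A → Set} (P? : Decidable P) (h f : A → ℚ) →
  (∀ x → P x → h x ≡ f x) → (∀ x → ¬ P x → f x ≡ 0ℚ) → ∀ xs → sumℚ (map h (filter P? xs)) ≡ sumℚ (map f xs)
sumℚ-filter P? h f h≡f f≡0 [] = refl
sumℚ-filter P? h f h≡f f≡0 (x ∷ xs) with P? x
... | yes px = cong₂ _+_ (h≡f x px) (sumℚ-filter P? h f h≡f f≡0 xs)
... | no ¬px = trans (sumℚ-filter P? h f h≡f f≡0 xs)
  (trans (sym (ℚP.+-identityˡ _)) (cong (_+ sumℚ (map f xs)) (sym (f≡0 x ¬px))))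

shift-self : ∀ n f → shift n f n ≡ f 0
shift-self zero    f = refl
shift-self (suc n) f = shift-self n f

-- For `f` supported at 0, `shift w f n` is `f 0` times the indicator of w = n, which reproduces the
-- filter in `partitions`.
shift-other : ∀ w n f → (∀ m → f (suc m) ≡ 0ℚ) → w ≢ n → shift w f n ≡ 0ℚ
shift-other zero    zero    f f≡0 w≢n = ⊥-elim (w≢n refl)
shift-other zero    (suc n) f f≡0 w≢n = f≡0 n
shift-other (suc w) zero    f f≡0 w≢n = refl
shift-other (suc w) (suc n) f f≡0 w≢n = shift-other w n f f≡0 (w≢n ∘ cong suc)

balance-[] : ∀ xs → balance xs [] ≡ + 0
balance-[] []      = refl
balance-[] (_ ∷ _) = refl

balance-R : ∀ rs xs cs → balance (map R-part rs ++ xs) cs ≡ + sum (take (length rs) cs) ℤ.+ balance xs (drop (length rs) cs)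
balance-R []       xs cs       = sym (ℤP.+-identityˡ (balance xs cs))
balance-R (r ∷ rs) xs []       = sym (cong (ℤ._+_ (+ 0)) (balance-[] xs))
balance-R (r ∷ rs) xs (c ∷ cs) = begin
  + 1 ℤ.* + c ℤ.+ balance (map R-part rs ++ xs) cs  ≡⟨ cong₂ ℤ._+_ (ℤP.*-identityˡ (+ c)) (balance-R rs xs cs) ⟩
  + c ℤ.+ (+ s ℤ.+ b)                               ≡⟨ ℤP.+-assoc (+ c) (+ s) b ⟨
  + (c ℕ.+ s) ℤ.+ b                                 ∎
  where
  open ≡-Reasoning
  s = sum (take (length rs) cs)
  b = balance xs (drop (length rs) cs)

balance-S : ∀ ss xs cs → balance (map S-part ss ++ xs) cs ≡ ℤ.- (+ sum (take (length ss) cs)) ℤ.+ balance xs (drop (length ss) cs)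
balance-S []       xs cs       = sym (ℤP.+-identityˡ (balance xs cs))
balance-S (s ∷ ss) xs []       = sym (cong (ℤ._+_ (+ 0)) (balance-[] xs))
balance-S (s ∷ ss) xs (c ∷ cs) = begin
  -[1+ 0 ] ℤ.* + c ℤ.+ balance (map S-part ss ++ xs) cs  ≡⟨ cong₂ ℤ._+_ (ℤP.-1*i≡-i (+ c)) (balance-S ss xs cs) ⟩
  ℤ.- (+ c) ℤ.+ (ℤ.- (+ u) ℤ.+ b)                        ≡⟨ ℤP.+-assoc (ℤ.- (+ c)) (ℤ.- (+ u)) b ⟨
  ℤ.- (+ c) ℤ.+ ℤ.- (+ u) ℤ.+ b                          ≡⟨ cong (ℤ._+ b) (ℤP.neg-distrib-+ (+ c) (+ u)) ⟨
  ℤ.- (+ (c ℕ.+ u)) ℤ.+ b                                ∎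
  where
  open ≡-Reasoning
  u = sum (take (length ss) cs)
  b = balance xs (drop (length ss) cs)

balance-neutral : ∀ is cs → balance (map neutral is) cs ≡ + 0
balance-neutral []       cs       = refl
balance-neutral (i ∷ is) []       = refl
balance-neutral (i ∷ is) (c ∷ cs) = trans (ℤP.+-identityˡ _) (balance-neutral is cs)

balance-tagged : ∀ rs ss is cs → balance (tagged rs ss is) cs
  ≡ sum (take (length rs) cs) ℤ.⊖ sum (take (length ss) (drop (length rs) cs))
balance-tagged rs ss is cs = begin
  balance (tagged rs ss is) cs        ≡⟨ balance-R rs _ cs ⟩
  + u ℤ.+ balance (map S-part ss ++ map neutral is) cs′   ≡⟨ cong (ℤ._+_ (+ u)) (balance-S ss _ cs′) ⟩
  + u ℤ.+ (ℤ.- (+ v) ℤ.+ balance (map neutral is) (drop (length ss) cs′)) ≡⟨ cong (λ b → + u ℤ.+ (ℤ.- (+ v) ℤ.+ b)) (balance-neutral is _) ⟩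
  + u ℤ.+ (ℤ.- (+ v) ℤ.+ + 0)         ≡⟨ cong (ℤ._+_ (+ u)) (ℤP.+-identityʳ (ℤ.- (+ v))) ⟩
  + u ℤ.+ ℤ.- (+ v)                   ≡⟨ ℤP.m-n≡m⊖n u v ⟩
  u ℤ.⊖ v                             ∎
  where
  open ≡-Reasoning
  cs′ = drop (length rs) cs
  u = sum (take (length rs) cs)
  v = sum (take (length ss) cs′)

1[⊖>0]-yes : ∀ u v → v < u → 1[ u ℤ.⊖ v >0] ≡ 1ℚ
1[⊖>0]-yes (suc u) zero    _         = refl
1[⊖>0]-yes (suc u) (suc v) (s≤s v<u) = trans (cong 1[_>0] (ℤP.[1+m]⊖[1+n]≡m⊖n u v)) (1[⊖>0]-yes u v v<u)

1[⊖>0]-no : ∀ u v → ¬ (v < u) → 1[ u ℤ.⊖ v >0] ≡ 0ℚ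
1[⊖>0]-no zero    zero    _   = refl
1[⊖>0]-no zero    (suc v) _   = refl
1[⊖>0]-no (suc u) zero    v≮u = ⊥-elim (v≮u (s≤s z≤n))
1[⊖>0]-no (suc u) (suc v) v≮u = trans (cong 1[_>0] (ℤP.[1+m]⊖[1+n]≡m⊖n u v)) (1[⊖>0]-no u v (v≮u ∘ s≤s))

pRSI-count : ∀ {l m} (R : Vec ℕ l) (S : Vec ℕ m) I → Positive (toList R) → Positive (toList S) → Positive I →
  ∀ n → toℚ (pRSI R S I n) ≡ count (parts R S I) n
pRSI-count R S I pR pS pI n = begin
  toℚ (pRSI R S I n)
    ≡⟨ length-filter (λ c → weight as c ℕ.≟ n) f
         (λ { c refl → shift-self (weight as c) (δ (+ 0 ℤ.+ balance xs c)) })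
         (λ c w≢n → shift-other (weight as c) n (δ (+ 0 ℤ.+ balance xs c)) (λ _ → refl) w≢n) (bounded (length as) n) ⟩
  sumℚ (map f (bounded (length as) n))
    ≡⟨ enumerate-F δ pxs (sizes-tagged (toList R) (toList S) I) n ⟩
  F δ xs (+ 0) n
    ≡⟨ F-δ pxs (+ 0) n ⟩
  count (map proj₁ xs) n
    ≡⟨ cong (λ l → count l n) (sizes-tagged (toList R) (toList S) I) ⟩
  count as n ∎
  where
  open ≡-Reasoning
  as = parts R S I
  xs = tagged (toList R) (toList S) I
  pxs : All Pos xs
  pxs = tagged-All pR pS pI
  f : List ℕ → ℚ
  f c = shift (weight as c) (δ (+ 0 ℤ.+ balance xs c)) n

length-toList : ∀ {A : Set} {n} (v : Vec A n) → length (toList v) ≡ n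
length-toList Vec.[]      = refl
length-toList (_ Vec.∷ v) = cong suc (length-toList v)

pR>S-excess : ∀ {l m} (R : Vec ℕ l) (S : Vec ℕ m) I → Positive (toList R) → Positive (toList S) → Positive I →
  ∀ n → toℚ (pR>S R S I n) ≡ excess (toList R) (toList S) I n
pR>S-excess {l} {m} R S I pR pS pI n = begin
  toℚ (pR>S R S I n)
    ≡⟨ length-filter (λ c → partsInS R S c ℕ.<? partsInR R S c) h
         (λ c → 1[⊖>0]-yes (partsInR R S c) (partsInS R S c))
         (λ c → 1[⊖>0]-no (partsInR R S c) (partsInS R S c)) (partitions as n) ⟩
  sumℚ (map h (partitions as n))
    ≡⟨ sumℚ-filter (λ c → weight as c ℕ.≟ n) h f h≡f
         (λ c w≢n → shift-other (weight as c) n (δ⁺ (+ 0 ℤ.+ balance xs c)) (λ _ → refl) w≢n) (bounded (length as) n) ⟩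
  sumℚ (map f (bounded (length as) n))
    ≡⟨ enumerate-F δ⁺ (tagged-All pR pS pI) (sizes-tagged (toList R) (toList S) I) n ⟩
  excess (toList R) (toList S) I n ∎
  where
  open ≡-Reasoning
  as = parts R S I
  xs = tagged (toList R) (toList S) I
  f h : List ℕ → ℚ
  f c = shift (weight as c) (δ⁺ (+ 0 ℤ.+ balance xs c)) n
  h c = 1[ partsInR R S c ℤ.⊖ partsInS R S c >0]
  balance-eq : ∀ c → + 0 ℤ.+ balance xs c ≡ partsInR R S c ℤ.⊖ partsInS R S c
  balance-eq c = trans (ℤP.+-identityˡ (balance xs c)) (trans (balance-tagged (toList R) (toList S) I c)
    (cong₂ (λ l m → sum (take l c) ℤ.⊖ sum (take m (drop l c))) (length-toList R) (length-toList S)))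
  h≡f : ∀ c → weight as c ≡ n → h c ≡ f c
  h≡f c refl = trans (cong 1[_>0] (sym (balance-eq c))) (sym (shift-self (weight as c) (δ⁺ (+ 0 ℤ.+ balance xs c))))

-- From counts to quotients

Coprime⇒nonempty : ∀ {as} → Coprime as → ∃ λ k → length as ≡ suc k
-- Every number divides all members of the empty list, so 2 would have to be 1.
Coprime⇒nonempty {[]}     cop with () ← cop 2 []
Coprime⇒nonempty {_ ∷ as} cop = length as , refl

/-*-cancel : ∀ a b .{{_ : NonZero b}} → (+ a / b) * toℚ b ≡ toℚ a
/-*-cancel a b@(suc b-1) = ℚP.toℚᵘ-injective (begin
  Q.toℚᵘ ((+ a / b) * toℚ b)                     ≈⟨ ℚP.toℚᵘ-homo-* (+ a / b) (toℚ b) ⟩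
  Q.toℚᵘ (+ a / b) ℚᵘ.* Q.toℚᵘ (toℚ b)           ≈⟨ ℚᵘP.*-cong (ℚP.toℚᵘ-fromℚᵘ (ℚᵘ.mkℚᵘ (+ a) b-1)) (toℚᵘ-toℚ b) ⟩
  ℚᵘ.mkℚᵘ (+ a) b-1 ℚᵘ.* ℚᵘ.mkℚᵘ (+ b) 0         ≈⟨ ℚᵘ.*≡* (trans (ℤP.*-identityʳ (+ a ℤ.* + b)) (cong (λ d → + a ℤ.* + d) (sym (ℕP.*-identityʳ b)))) ⟩
  ℚᵘ.mkℚᵘ (+ a) 0                                ≈⟨ toℚᵘ-toℚ a ⟨
  Q.toℚᵘ (toℚ a)                                 ∎)
  where open ℚᵘP.≃-Reasoning

quotient-close : ∀ a b L {ε} → 0ℚ Q.< ε → ∣ toℚ a - L * toℚ b ∣ Q.< ε * toℚ b →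
  Σ (NonZero b) λ nz → ∣ _/_ (+ a) b {{nz}} - L ∣ Q.< ε
-- With denominator 0 the hypothesis would put an absolute value strictly below 0.
quotient-close a zero L {ε} 0<ε close =
  ⊥-elim (ℚP.<-irrefl refl (ℚP.≤-<-trans (ℚP.0≤∣p∣ _) (subst (∣ toℚ a - L * 0ℚ ∣ Q.<_) (ℚP.*-zeroʳ ε) close)))
quotient-close a b@(suc _) L {ε} 0<ε close = _ , ℚP.*-cancelʳ-<-nonNeg (toℚ b) {{Q.nonNegative (0≤toℚ b)}}
  (subst (Q._< ε * toℚ b) (sym eq) close)
  where
  open ≡-Reasoning
  lem : ∀ x y z → (x - y) * z ≡ x * z - y * z
  lem = solve-∀ ℚ-ring
  eq : ∣ + a / b - L ∣ * toℚ b ≡ ∣ toℚ a - L * toℚ b ∣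
  eq = begin
    ∣ + a / b - L ∣ * toℚ b        ≡⟨ cong (∣ + a / b - L ∣ *_) (ℚP.0≤p⇒∣p∣≡p (0≤toℚ b)) ⟨
    ∣ + a / b - L ∣ * ∣ toℚ b ∣    ≡⟨ ℚP.∣p*q∣≡∣p∣*∣q∣ (+ a / b - L) (toℚ b) ⟨
    ∣ (+ a / b - L) * toℚ b ∣      ≡⟨ cong ∣_∣ (lem (+ a / b) L (toℚ b)) ⟩
    ∣ (+ a / b) * toℚ b - L * toℚ b ∣ ≡⟨ cong (λ q → ∣ q - L * toℚ b ∣) (/-*-cancel a b) ⟩
    ∣ toℚ a - L * toℚ b ∣          ∎

toList-Positive : ∀ {n} (v : Vec ℕ n) → (∀ i → 0 < lookup v i) → Positive (toList v)
toList-Positive v pos = subst Positive (tabulate-lookup v) (AllP.tabulate⁺ pos)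

toList-Unique : ∀ {n} (v : Vec ℕ n) → (∀ i j → lookup v i ≡ lookup v j → i ≡ j) → Unique (toList v)
toList-Unique v inj = subst Unique (tabulate-lookup v) (UniqueP.tabulate⁺ λ {i} {j} → inj i j)

theorem1 : ∀ {l m} (R : Vec ℕ l) (S : Vec ℕ m) (I : List ℕ) →
    (∀ i → 0 < lookup R i) → (∀ i j → lookup R i ≡ lookup R j → i ≡ j) →
    (∀ k → 0 < lookup S k) → (∀ i j → lookup S i ≡ lookup S j → i ≡ j) →
    (∀ i k → lookup R i ≢ lookup S k) →
    All (λ x → 0 < x) I → Unique I → All (λ x → x ∉ toList R ++ toList S) I →
    gcdAll (toList R ++ toList S) ≡ 1 →
    (ε : ℚ) → 0ℚ Q.< ε →
    ∃ λ N → ∀ n → N ≤ n →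
      Σ (NonZero (pRSI R S I n)) λ nz →
        ∣ _/_ (+ pR>S R S I n) (pRSI R S I n) {{nz}} - limitValue R S ∣ Q.< ε
theorem1 R S I R>0 R-inj S>0 _ _ I>0 _ _ gcd≡1 ε 0<ε = proj₁ close , λ n N≤n →
  quotient-close (pR>S R S I n) (pRSI R S I n) (limitValue R S) 0<ε
    (subst₂ (λ e c → ∣ e - limitValue R S * c ∣ Q.< ε * c)
      (sym (pR>S-excess R S I pR pS I>0 n)) (sym (pRSI-count R S I pR pS I>0 n))
      (subst (λ L → ∣ excess rs ss I n - L * count as n ∣ Q.< ε * count as n)
        (sym (limitValue-density R S)) (proj₂ close n N≤n)))
  where
  rs = toList R
  ss = toList S
  as = parts R S I
  pR : Positive rs
  pR = toList-Positive R R>0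
  pS : Positive ss
  pS = toList-Positive S S>0
  pas : Positive as
  pas = AllP.++⁺ pR (AllP.++⁺ pS I>0)
  cop : Coprime as
  -- A common divisor of all parts divides in particular those in R and S.
  cop d d∣as with AllP.++⁻ rs d∣as
  ... | d∣rs , d∣′ = gcdAll≡1⇒Coprime gcd≡1 d (AllP.++⁺ d∣rs (proj₁ (AllP.++⁻ ss d∣′)))
  close : ∃ λ N → ∀ n → N ≤ n → ∣ excess rs ss I n - ∏ rs * ∏ ss * density rs ss * count as n ∣ Q.< ε * count as n
  close with Coprime⇒nonempty cop
  ... | k , len = ratio-limit {L = ∏ rs * ∏ ss * density rs ss} {c = count as} (∏-pos pas) (count-≈-ones as 0 pas cop len)
    (excess-count-≈ rs ss I pR pS I>0 (toList-Unique R R-inj) cop len) 0<ε
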